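{- Let $(W,S)$ be a finite Coxeter system, $Q=q_1\cdots q_m$ a word on $S$, and $\rho\in W$. Let $I\neq\mathsf P(Q,\rho)$ be a facet of $\mathcal{SC}(Q,\rho)$. Define $y$ to be the largest position in $[m]$ such that $$\{i-y+1 : i\in I,\ i\ge y\}\ne\mathsf P\big(q_y\cdots q_m,\ \Pi Q_{[y,m]\setminus I}\big),$$ and $x$ to be the largest position in $I$ such that $\mathsf r(I,x)=-\mathsf r(I,y)$. Then the father of $I$ in the positive source tree $\mathcal P(Q,\rho)$ is obtained from $I$ by flipping $x$.
   Context: Let $(W,S)$ be a finite Coxeter system acting by reflections on a Euclidean space $V$, with length function $\ell$, root system $\Phi=\Phi^+\sqcup\Phi^-$ and simple roots $\{\alpha_s: s\in S\}$. For a word $Q=q_1q_2\cdots q_m$ in the letters $S$ and $\rho\in W$, write $[m]=\{1,\dots,m\}$, $[y,m]=\{y,\dots,m\}$, and for $X\subseteq[m]$ let $\Pi Q_X\in W$ be the product of the reflections $q_x$, $x\in X$, in increasing order of position. The subword complex $\mathcal{SC}(Q,\rho)$ is the simplicial complex whose facets are the sets $I\subseteq[m]$ such that the letters of $Q$ at the positions in $[m]\setminus I$, read in increasing order of position, form a reduced expression of $\rho$. Positions in any word are numbered from $1$. The root function of a facet $I$ is $\mathsf r(I,k)=\Pi Q_{[k-1]\setminus I}(\alpha_{q_k})\in\Phi$ for $k\in[m]$. Two distinct facets $I,J$ are adjacent if $I\setminus\{i\}=J\setminus\{j\}$ for some $i\in I$, $j\in J$; then $J$ is obtained from $I$ by flipping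 $i$ (given $I$ and $i$, the facet $J\ne I$ is unique if it exists). The flip is increasing if $i<j$. The increasing flip graph $\mathcal G(Q,\rho)$ is the directed graph whose vertices are the facets and whose edges $I\to J$ are the increasing flips. For an edge $I\to J$ with $I\setminus\{i\}=J\setminus\{j\}$, $i<j$, set $\mathsf p(I\to J)=i$. A path is $\mathsf p$-rising if the sequence of $\mathsf p$-labels of its successive edges is strictly increasing. When $\mathcal{SC}(Q,\rho)$ is non-empty, the positive greedy facet $\mathsf P(Q,\rho)$ is the unique source of $\mathcal G(Q,\rho)$ (equivalently the lexicographically smallest facet). The positive source tree $\mathcal P(Q,\rho)$ is the spanning tree of $\mathcal G(Q,\rho)$, rooted at $\mathsf P(Q,\rho)$, formed by all $\mathsf p$-rising paths from $\mathsf P(Q,\rho)$ to the facets (there is exactly one to each facet); the father of $I\neq\mathsf P(Q,\rho)$ is the facet preceding $I$ on the $\mathsf p$-rising path from $\mathsf P(Q,\rho)$ to $I$. -}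

module Defs where

open import Level using (_⊔_) renaming (suc to lsuc)
open import Algebra.Bundles using (CommutativeRing; Group)
open import Algebra.Module.Bundles using (Module)
open import Data.Fin.Base as Fin using (Fin; zero; suc; toℕ)
open import Data.Fin.Properties using (_<?_)
open import Data.Fin.Subset using (Subset; inside; outside; ∁; _∈_; _─_; _-_)
open import Data.List.Base using (List; []; _∷_; _++_; length; map; foldr; replicate; concat)
open import Data.List.Relation.Unary.Linked using (Linked)
open import Data.Nat.Base as ℕ using (ℕ; _∸_)
open import Data.Product.Base using (∃-syntax; Σ-syntax; _×_)
open import Data.Sum.Base using (_⊎_)
open import Data.Vec.Base as Vec using (Vec; []; _∷_; lookup; tabulate)
open import Function.Bundles using (_⇔_)
open import Relation.Binary.Construct.Closure.Equivalence using (EqClosure)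
open import Relation.Binary.Construct.Closure.ReflexiveTransitive using (Star; _◅_; _◅◅_) renaming (ε to nil)
open import Relation.Binary.Core using (Rel)
open import Relation.Binary.PropositionalEquality.Core using (_≡_; _≢_)
open import Relation.Binary.Structures using (IsStrictTotalOrder)
open import Relation.Nullary using (¬_)
open import Relation.Nullary.Decidable.Core using (does)
open import Relation.Unary using (Pred)

import Algebra.Properties.Monoid.Sum as MonoidSum
import Data.List.Membership.Setoid as Membership
import Data.List.Relation.Unary.Enumerates.Setoid as Enumerates

-- There are no real numbers in the library.  Scalars are taken in an
-- arbitrary ordered field with decidable order, of which ℝ is (classically)
-- an instance; over ℝ, `EuclideanSpace` is the usual notion.

record OrderedField c ℓ₁ ℓ₂ : Set (lsuc (c ⊔ ℓ₁ ⊔ ℓ₂)) where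
  infix  4 _<_ _≤_
  infix  8 _⁻¹
  field
    commutativeRing : CommutativeRing c ℓ₁
  open CommutativeRing commutativeRing public
  field
    _<_                : Rel Carrier ℓ₂
    isStrictTotalOrder : IsStrictTotalOrder _≈_ _<_
    0<1                : 0# < 1#
    +-monoˡ-<          : ∀ {x y} z → x < y → x + z < y + z
    *-pos              : ∀ {x y} → 0# < x → 0# < y → 0# < x * y
    -- A total function; its value at 0# is irrelevant.
    _⁻¹                : Carrier → Carrier
    ⁻¹-cong            : ∀ {x y} → x ≈ y → x ⁻¹ ≈ y ⁻¹
    *-inverseʳ         : ∀ {x} → ¬ (x ≈ 0#) → x * x ⁻¹ ≈ 1#

  _≤_ : Rel Carrier (ℓ₁ ⊔ ℓ₂)
  x ≤ y = x < y ⊎ x ≈ y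

module LinearAlgebra {c ℓ₁ ℓ₂ v ℓv} (K : OrderedField c ℓ₁ ℓ₂)
                     (M : Module (OrderedField.commutativeRing K) v ℓv) where
  open OrderedField K
  open Module M
  open MonoidSum +ᴹ-monoid using (sum)

  lincomb : ∀ {n} → (Fin n → Carrier) → (Fin n → Carrierᴹ) → Carrierᴹ
  lincomb a x = sum (λ i → a i *ₗ x i)

  LinearlyIndependent : ∀ {n} → (Fin n → Carrierᴹ) → Set (c ⊔ ℓ₁ ⊔ ℓv)
  LinearlyIndependent x = ∀ a → lincomb a x ≈ᴹ 0ᴹ → ∀ i → a i ≈ 0#

  Spans : ∀ {n} → (Fin n → Carrierᴹ) → Set (c ⊔ v ⊔ ℓv)
  Spans x = ∀ u → ∃[ a ] u ≈ᴹ lincomb a x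

  NonnegativeCombination : ∀ {n} → (Fin n → Carrierᴹ) → Pred Carrierᴹ (c ⊔ ℓ₁ ⊔ ℓ₂ ⊔ ℓv)
  NonnegativeCombination x u = ∃[ a ] (∀ i → 0# ≤ a i) × u ≈ᴹ lincomb a x

record EuclideanSpace {c ℓ₁ ℓ₂} (K : OrderedField c ℓ₁ ℓ₂) v ℓv
       : Set (c ⊔ ℓ₁ ⊔ ℓ₂ ⊔ lsuc (v ⊔ ℓv)) where
  open OrderedField K
  field
    vectorSpace : Module commutativeRing v ℓv
  open Module vectorSpace public
  open LinearAlgebra K vectorSpace public
  field
    dim               : ℕ
    basis             : Fin dim → Carrierᴹ
    basis-independent : LinearlyIndependent basis
    basis-spans       : Spans basis

    ⟨_,_⟩       : Carrierᴹ → Carrierᴹ → Carrier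
    ⟨,⟩-cong    : ∀ {x x′ y y′} → x ≈ᴹ x′ → y ≈ᴹ y′ → ⟨ x , y ⟩ ≈ ⟨ x′ , y′ ⟩
    ⟨,⟩-comm    : ∀ x y → ⟨ x , y ⟩ ≈ ⟨ y , x ⟩
    ⟨,⟩-+ˡ      : ∀ x y z → ⟨ x +ᴹ y , z ⟩ ≈ ⟨ x , z ⟩ + ⟨ y , z ⟩
    ⟨,⟩-*ˡ      : ∀ a x y → ⟨ a *ₗ x , y ⟩ ≈ a * ⟨ x , y ⟩
    ⟨,⟩-posdef  : ∀ x → ¬ (x ≈ᴹ 0ᴹ) → 0# < ⟨ x , x ⟩

  -- The reflection in the hyperplane β^⊥; only meaningful for β nonzero.
  reflect : Carrierᴹ → Carrierᴹ → Carrierᴹ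
  reflect β x = x +ᴹ -ᴹ ((((1# + 1#) * ⟨ x , β ⟩) * ⟨ β , β ⟩ ⁻¹) *ₗ β)

module Presentation {n : ℕ} (m : Fin n → Fin n → ℕ) where

  data Relator : Rel (List (Fin n)) Level.zero where
    relator : ∀ u s t v →
              Relator (u ++ concat (replicate (m s t) (s ∷ t ∷ [])) ++ v) (u ++ v)

  -- Equality of words in ⟨ S ∣ (st)^m(s,t) = e ⟩.  Inverse letters are not
  -- needed because m s s = 1 makes every generator an involution.
  _∼_ : Rel (List (Fin n)) Level.zero
  _∼_ = EqClosure Relator

-- The set S of simple reflections is indexed by Fin rank.
record FiniteCoxeterSystem w ℓw : Set (lsuc (w ⊔ ℓw)) where
  field
    group : Group w ℓw
  open Group group public
  field
    rank    : ℕ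
    simple  : Fin rank → Carrier

    -- Finiteness of W makes every entry finite.
    m       : Fin rank → Fin rank → ℕ
    m-diag  : ∀ s → m s s ≡ 1
    m-sym   : ∀ s t → m s t ≡ m t s
    m-≥2    : ∀ s t → s ≢ t → 2 ℕ.≤ m s t

  open Presentation m public

  product : List (Fin rank) → Carrier
  product u = foldr _∙_ ε (map simple u)

  field
    generated : ∀ x → ∃[ u ] product u ≈ x
    presented : ∀ u v → (product u ≈ product v) ⇔ (u ∼ v)

    elements  : List Carrier
    finite    : Enumerates.IsEnumeration setoid elements

  ReducedExpression : Carrier → List (Fin rank) → Set ℓw
  ReducedExpression x u =
    product u ≈ x × (∀ v → product v ≈ x → length u ℕ.≤ length v)

module _ {c ℓ₁ ℓ₂ v ℓv} {K : OrderedField c ℓ₁ ℓ₂} (V : EuclideanSpace K v ℓv) where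
  open OrderedField K
  open EuclideanSpace V
  open Membership ≈ᴹ-setoid using () renaming (_∈_ to _∈ᴹ_)

  record IsRootSystem (Φ : List Carrierᴹ) : Set (c ⊔ ℓ₁ ⊔ v ⊔ ℓv) where
    field
      nonzero : ∀ {β} → β ∈ᴹ Φ → ¬ (β ≈ᴹ 0ᴹ)
      reduced : ∀ {β} → β ∈ᴹ Φ → ∀ a → (a *ₗ β) ∈ᴹ Φ ⇔ (a ≈ 1# ⊎ a ≈ - 1#)
      stable  : ∀ {β γ} → β ∈ᴹ Φ → γ ∈ᴹ Φ → reflect β γ ∈ᴹ Φ

  -- The positive roots Φ⁺ are the roots that are nonnegative combinations of
  -- the simple roots; Φ⁻ = -Φ⁺.
  record IsSimpleSystem (Φ : List Carrierᴹ) {n : ℕ} (α : Fin n → Carrierᴹ)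
         : Set (c ⊔ ℓ₁ ⊔ ℓ₂ ⊔ v ⊔ ℓv) where
    field
      isRoot      : ∀ s → α s ∈ᴹ Φ
      independent : LinearlyIndependent α
      sign        : ∀ {β} → β ∈ᴹ Φ →
                    NonnegativeCombination α β ⊎ NonnegativeCombination α (-ᴹ β)

record ReflectionAction {w ℓw c ℓ₁ ℓ₂ v ℓv} (𝒲 : FiniteCoxeterSystem w ℓw)
       {K : OrderedField c ℓ₁ ℓ₂} (V : EuclideanSpace K v ℓv)
       : Set (w ⊔ ℓw ⊔ c ⊔ ℓ₁ ⊔ ℓ₂ ⊔ v ⊔ ℓv) where
  open FiniteCoxeterSystem 𝒲
  open EuclideanSpace V
  infixr 7 _▷_
  field
    _▷_        : Carrier → Carrierᴹ → Carrierᴹ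
    ▷-cong     : ∀ {x y u u′} → x ≈ y → u ≈ᴹ u′ → x ▷ u ≈ᴹ y ▷ u′
    ▷-identity : ∀ u → ε ▷ u ≈ᴹ u
    ▷-assoc    : ∀ x y u → (x ∙ y) ▷ u ≈ᴹ x ▷ y ▷ u
    ▷-faithful : ∀ x → (∀ u → x ▷ u ≈ᴹ u) → x ≈ ε

    Φ              : List Carrierᴹ
    isRootSystem   : IsRootSystem V Φ
    α              : Fin rank → Carrierᴹ
    isSimpleSystem : IsSimpleSystem V Φ α
    ▷-simple       : ∀ s u → simple s ▷ u ≈ᴹ reflect (α s) u

-- Position k of the text is the element of Fin m with toℕ equal to k - 1.

subword : ∀ {a} {A : Set a} {m} → Vec A m → Subset m → List A
subword []      []            = []
subword (q ∷ Q) (inside  ∷ X) = q ∷ subword Q X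
subword (q ∷ Q) (outside ∷ X) = subword Q X

-- The set [k-1] of positions strictly before k, and the set [k,m].
before from : ∀ {m} → Fin m → Subset m
before k = tabulate (λ i → does (i <? k))
from   k = ∁ (before k)

-- For a word Q, this is q_y ⋯ q_m; for (the characteristic vector of) a
-- subset I of [m], this is the renumbered subset {i - y + 1 : i ∈ I, i ≥ y}.
suffix : ∀ {a} {A : Set a} {m} (y : Fin m) → Vec A m → Vec A (m ∸ toℕ y)
suffix zero    xs       = xs
suffix (suc y) (x ∷ xs) = suffix y xs

Largest : ∀ {m p} → Pred (Fin m) p → Pred (Fin m) p
Largest P k = P k × (∀ j → P j → j Fin.≤ k)

record Exchange {m : ℕ} (I : Subset m) (i : Fin m) (J : Subset m) (j : Fin m) : Set where
  field
    distinct : I ≢ J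
    i∈I      : i ∈ I
    j∈J      : j ∈ J
    same     : I - i ≡ J - j

module SubwordComplex {w ℓw} (𝒲 : FiniteCoxeterSystem w ℓw) where
  open FiniteCoxeterSystem 𝒲 hiding (m)

  Word : ℕ → Set
  Word = Vec (Fin rank)

  Π : ∀ {m} → Word m → Subset m → Carrier
  Π Q X = product (subword Q X)

  IsFacet : ∀ {m} → Word m → Carrier → Pred (Subset m) ℓw
  IsFacet Q ρ I = ReducedExpression ρ (subword Q (∁ I))

  ObtainedByFlipping : ∀ {m} → Word m → Carrier →
                       Subset m → Fin m → Subset m → Set ℓw
  ObtainedByFlipping Q ρ I i J =
    IsFacet Q ρ I × IsFacet Q ρ J × ∃[ j ] Exchange I i J j

  -- The edges of the increasing flip graph; `out` is the label 𝗉.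
  record IncreasingFlip {m} (Q : Word m) (ρ : Carrier) (I J : Subset m) : Set ℓw where
    field
      facetˡ     : IsFacet Q ρ I
      facetʳ     : IsFacet Q ρ J
      out        : Fin m
      into       : Fin m
      exchange   : Exchange I out J into
      increasing : out Fin.< into

  IsSource : ∀ {m} → Word m → Carrier → Pred (Subset m) ℓw
  IsSource Q ρ P = IsFacet Q ρ P × (∀ I → ¬ IncreasingFlip Q ρ I P)

  -- P = 𝖯(Q,ρ): P is the unique source of the increasing flip graph.
  IsPositiveGreedy : ∀ {m} → Word m → Carrier → Pred (Subset m) ℓw
  IsPositiveGreedy Q ρ P = IsSource Q ρ P × (∀ P′ → IsSource Q ρ P′ → P′ ≡ P)

  Path : ∀ {m} → Word m → Carrier → Rel (Subset m) ℓw
  Path Q ρ = Star (IncreasingFlip Q ρ)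

  pLabels : ∀ {m} {Q : Word m} {ρ I J} → Path Q ρ I J → List (Fin m)
  pLabels nil     = []
  pLabels (e ◅ π) = IncreasingFlip.out e ∷ pLabels π

  Rising : ∀ {m} {Q : Word m} {ρ I J} → Path Q ρ I J → Set
  Rising π = Linked Fin._<_ (pLabels π)

  -- F is the father of I in the positive source tree rooted at P: some
  -- 𝗉-rising path from P to I has F as the facet just before I.
  IsFather : ∀ {m} (Q : Word m) (ρ : Carrier) (P I F : Subset m) → Set ℓw
  IsFather Q ρ P I F =
    Σ[ π ∈ Path Q ρ P F ] Σ[ e ∈ IncreasingFlip Q ρ F I ] Rising (π ◅◅ (e ◅ nil))

  -- {i - y + 1 : i ∈ I, i ≥ y} ≠ 𝖯(q_y ⋯ q_m, Π Q_([y,m] ∖ I)).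
  SuffixNotGreedy : ∀ {m} → Word m → Subset m → Pred (Fin m) ℓw
  SuffixNotGreedy Q I y =
    ¬ IsPositiveGreedy (suffix y Q) (Π Q (from y ─ I)) (suffix y I)

  module _ {c ℓ₁ ℓ₂ v ℓv} {K : OrderedField c ℓ₁ ℓ₂} {V : EuclideanSpace K v ℓv}
           (𝒜 : ReflectionAction 𝒲 V) where
    open EuclideanSpace V using (Carrierᴹ)
    open ReflectionAction 𝒜

    rootFunction : ∀ {m} → Word m → Subset m → Fin m → Carrierᴹ
    rootFunction Q I k = Π Q (before k ─ I) ▷ α (lookup Q k)

{-# OPTIONS --safe #-}

-- A facet is greedy exactly when its root function is positive on it; every
-- step below is an argument on signs of roots.
--
-- For Q = q Q′, a 𝗉-rising path from a greedy facet to I is built by recursion.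
-- Remove the first position from I and let P′ be the greedy facet at the start
-- of the path obtained for Q′.  If I contains the first position, or if P′
-- remains greedy in Q, the path is lifted to Q.  Otherwise let x be the last
-- position of P′ whose root is α_q: then {1} ∪ (P′ ∖ {x}) is greedy, and
-- flipping 1 to x leads to the start of the lifted path.
--
-- Conversely, if a greedy facet contains its first position, then an increasing
-- flip of that position to x leaves a greedy facet on the rest of the word.  So
-- along a rising path from 𝖯(Q,ρ) the suffix beyond the last label is greedy,
-- while the suffix starting at the last label is the target of an increasing
-- flip: the last label is y.  A position of I beyond the one flipped in whose
-- root is -r(y) would have had a negative root in the greedy suffix before the
-- flip; hence the position flipped in is x.

module Submission where

open import Defs
open import Level using (Level)
open import Algebra.Bundles using (CommutativeMonoid)
open import Data.Bool.Base using (if_then_else_)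
open import Data.Empty using (⊥; ⊥-elim)
open import Data.Fin.Base as Fin using (Fin; zero; suc)
open import Data.Fin.Properties as Finₚ using (_≟_; suc-injective)
open import Data.Fin.Subset as Subset using (Subset; Side; inside; outside; ∁; _∈_; _─_; _-_)
open import Data.List.Base as List using (List; []; _∷_; foldr; length)
open import Data.List.Relation.Unary.All as All using (All)
open import Data.List.Relation.Unary.AllPairs as AllPairs using (AllPairs)
open import Data.List.Relation.Unary.Linked as Linked using (Linked)
open import Data.Nat.Base as ℕ using (ℕ; suc; z<s; s<s; s<s⁻¹)
open import Data.Product.Base using (_,_; proj₁; proj₂; ∃-syntax; Σ-syntax; _×_)
open import Data.Sum.Base using (_⊎_; inj₁; inj₂)
open import Data.Vec.Base using (Vec; []; _∷_; lookup; tabulate; _[_]≔_; _[_]=_; here; there)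
open import Function.Base using (_∘_)
open import Function.Bundles using (Equivalence)
open import Relation.Binary.Construct.Closure.ReflexiveTransitive as Star using (_◅_; _◅◅_) renaming (ε to nil)
open import Relation.Binary.Definitions using (tri<; tri≈; tri>)
open import Relation.Binary.PropositionalEquality.Core as ≡ using (_≡_; _≢_)
open import Relation.Binary.Structures using (IsStrictTotalOrder)
open import Relation.Nullary using (¬_; yes; no; contradiction)
open import Relation.Nullary.Decidable.Core using (does)
open import Relation.Unary using (Pred)
import Algebra.Module.Properties as ModuleProperties
import Algebra.Properties.AbelianGroup as AbelianGroupProperties
import Algebra.Properties.CommutativeMonoid.Sum as Sum
import Algebra.Properties.CommutativeSemigroup as CommutativeSemigroupProperties
import Algebra.Properties.Group as GroupProperties
import Data.Fin.Subset.Properties as Subsetₚ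
import Data.List.Membership.Setoid as Membership
import Data.List.Membership.Setoid.Properties as Membershipₚ
import Data.List.Relation.Unary.Linked.Properties as Linkedₚ
import Data.Nat.Properties as ℕₚ
import Data.Vec.Properties as Vecₚ
import Relation.Binary.PropositionalEquality.Properties as ≡ₚ
import Relation.Binary.Reasoning.Setoid as ≈-Reasoning

private variable
  c ℓ₁ ℓ₂ v ℓv w ℓw ℓ ℓ′ : Level

-- Vector updates, extremal positions and exchanges

[]=⇒[]≔ : ∀ {A : Set ℓ} {m} (xs : Vec A m) {i x} → xs [ i ]= x → xs [ i ]≔ x ≡ xs
[]=⇒[]≔ (x ∷ xs) here          = ≡.refl
[]=⇒[]≔ (y ∷ xs) (there xs[i]) = ≡.cong (y ∷_) ([]=⇒[]≔ xs xs[i])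

[]=-change : ∀ {A : Set ℓ} {m} (xs : Vec A m) i {k x y z} → k ≢ i →
             xs [ i ]≔ x [ k ]= z → xs [ i ]≔ y [ k ]= z
[]=-change xs i {k} {x} {y} k≢i xs[k] =
  ≡.subst (_[ k ]= _) (Vecₚ.[]≔-idempotent xs i) (Vecₚ.[]≔-minimal (xs [ i ]≔ x) k i k≢i xs[k])

∈[]≔outside⇒≢ : ∀ {m} (I : Subset m) x {k} → k ∈ I [ x ]≔ outside → k ≢ x
∈[]≔outside⇒≢ I x k∈ ≡.refl with Vecₚ.[]=-injective k∈ (Vecₚ.[]≔-updates I x)
... | ()

-- The given choice between `P` and `Q` takes the place of decidability. The later positions are
-- settled first, so `zero` is chosen only when `Q` holds at all of them.
last-or-all : ∀ {m} {P : Pred (Fin m) ℓ} {Q : Pred (Fin m) ℓ′} → (∀ k → P k ⊎ Q k) →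
              (∃[ x ] P x × (∀ k → x Fin.< k → Q k)) ⊎ (∀ k → Q k)
last-or-all {m = ℕ.zero}  P⊎Q = inj₂ λ ()
last-or-all {m = ℕ.suc m} P⊎Q with last-or-all (P⊎Q ∘ suc)
... | inj₁ (x , Px , Q>x) = inj₁ (suc x , Px , λ { (suc k) x<k → Q>x k (s<s⁻¹ x<k) })
... | inj₂ Qsuc with P⊎Q zero
...   | inj₁ P0 = inj₁ (zero , P0 , λ { (suc k) _ → Qsuc k })
...   | inj₂ Q0 = inj₂ λ { zero → Q0 ; (suc k) → Qsuc k }

Largest-unique : ∀ {m} {P : Pred (Fin m) ℓ} {i j} → Largest P i → Largest P j → i ≡ j
Largest-unique {i = i} {j} (Pi , i-max) (Pj , j-max) = Finₚ.≤-antisym (j-max i Pi) (i-max j Pj)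

exchange-sym : ∀ {m} {I J : Subset m} {i j} → Exchange I i J j → Exchange J j I i
exchange-sym e = record
  { distinct = λ J≡I → distinct (≡.sym J≡I) ; i∈I = j∈J ; j∈J = i∈I ; same = ≡.sym same }
  where open Exchange e

-- Reflections

module OrderedFieldProperties (K : OrderedField c ℓ₁ ℓ₂) where
  open OrderedField K hiding (zero)
  private module O = IsStrictTotalOrder isStrictTotalOrder

  <⇒≉0 : ∀ {x} → 0# < x → ¬ (x ≈ 0#)
  <⇒≉0 0<x x≈0 = O.irrefl (sym x≈0) 0<x

  +-nonneg-zeroˡ : ∀ {x y} → 0# ≤ x → 0# ≤ y → x + y ≈ 0# → x ≈ 0#
  +-nonneg-zeroˡ         (inj₂ 0≈x) 0≤y        x+y≈0 = sym 0≈x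
  +-nonneg-zeroˡ {x} {y} (inj₁ 0<x) (inj₁ 0<y) x+y≈0 = contradiction x+y≈0
    (<⇒≉0 (O.trans 0<y (O.<-respˡ-≈ (+-identityˡ y) (+-monoˡ-< y 0<x))))
  +-nonneg-zeroˡ {x} {y} (inj₁ 0<x) (inj₂ 0≈y) x+y≈0 =
    trans (sym (+-identityʳ x)) (trans (+-congˡ 0≈y) x+y≈0)

  ≤-respʳ : ∀ {x y z} → y ≈ z → x ≤ y → x ≤ z
  ≤-respʳ y≈z (inj₁ x<y) = inj₁ (O.<-respʳ-≈ y≈z x<y)
  ≤-respʳ y≈z (inj₂ x≈y) = inj₂ (trans x≈y y≈z)

  0≰-1 : ¬ (0# ≤ - 1#)
  0≰-1 0≤-1 = <⇒≉0 0<1 (+-nonneg-zeroˡ (inj₁ 0<1) 0≤-1 (-‿inverseʳ 1#))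

module EuclideanSpaceProperties {K : OrderedField c ℓ₁ ℓ₂} (V : EuclideanSpace K v ℓv) where
  open OrderedField K hiding (zero)
  open OrderedFieldProperties K
  open EuclideanSpace V
  open ModuleProperties vectorSpace public using (inverseˡ-uniqueᴹ; inverseʳ-uniqueᴹ; -ᴹ-involutive)
  open AbelianGroupProperties +ᴹ-abelianGroup public
    using () renaming (⁻¹-∙-comm to -ᴹ-+ᴹ-comm)
  open AbelianGroupProperties +-abelianGroup using () renaming (inverseʳ-unique to +-inverseʳ-unique)
  open Sum +ᴹ-commutativeMonoid using (sum-cong-≋; ∑-distrib-+; sum-replicate-zero)
  private module +ᴹ = CommutativeSemigroupProperties
            (CommutativeMonoid.commutativeSemigroup +ᴹ-commutativeMonoid)
  private module *ᴷ = CommutativeSemigroupProperties *-commutativeSemigroup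

  *ₗ-neg : ∀ a x → a *ₗ (-ᴹ x) ≈ᴹ -ᴹ (a *ₗ x)
  *ₗ-neg a x = inverseˡ-uniqueᴹ _ _ (begin
    a *ₗ (-ᴹ x) +ᴹ a *ₗ x ≈⟨ *ₗ-distribˡ a (-ᴹ x) x ⟨
    a *ₗ (-ᴹ x +ᴹ x)      ≈⟨ *ₗ-congˡ (-ᴹ‿inverseˡ x) ⟩
    a *ₗ 0ᴹ               ≈⟨ *ₗ-zeroʳ a ⟩
    0ᴹ                    ∎)
    where open ≈-Reasoning ≈ᴹ-setoid

  lincomb-+ : ∀ {n} (a b : Fin n → Carrier) x →
              lincomb (λ i → a i + b i) x ≈ᴹ lincomb a x +ᴹ lincomb b x
  lincomb-+ {n} a b x =
    ≈ᴹ-trans (sum-cong-≋ {n} (λ i → *ₗ-distribʳ (x i) (a i) (b i)))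
             (∑-distrib-+ (λ i → a i *ₗ x i) (λ i → b i *ₗ x i))

  lincomb-zero : ∀ {n} (a : Fin n → Carrier) x → (∀ i → a i ≈ 0#) → lincomb a x ≈ᴹ 0ᴹ
  lincomb-zero {n} a x a≈0 = ≈ᴹ-trans
    (sum-cong-≋ {n} λ i → ≈ᴹ-trans (*ₗ-congʳ (a≈0 i)) (*ₗ-zeroˡ (x i)))
    (sum-replicate-zero n)

  lincomb-single : ∀ {n} (a : Fin n → Carrier) x s → (∀ i → i ≢ s → a i ≈ 0#) →
                   lincomb a x ≈ᴹ a s *ₗ x s
  lincomb-single a x zero a≈0 = begin
    a zero *ₗ x zero +ᴹ _  ≈⟨ +ᴹ-congˡ (lincomb-zero (a ∘ suc) (x ∘ suc) λ i → a≈0 (suc i) λ ()) ⟩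
    a zero *ₗ x zero +ᴹ 0ᴹ ≈⟨ +ᴹ-identityʳ _ ⟩
    a zero *ₗ x zero       ∎
    where open ≈-Reasoning ≈ᴹ-setoid
  lincomb-single a x (suc s) a≈0 = begin
    a zero *ₗ x zero +ᴹ _ ≈⟨ +ᴹ-cong (≈ᴹ-trans (*ₗ-congʳ (a≈0 zero λ ())) (*ₗ-zeroˡ _))
                               (lincomb-single (a ∘ suc) (x ∘ suc) s
                                 λ i i≢s → a≈0 (suc i) (i≢s ∘ suc-injective)) ⟩
    0ᴹ +ᴹ _               ≈⟨ +ᴹ-identityˡ _ ⟩
    a (suc s) *ₗ x (suc s) ∎
    where open ≈-Reasoning ≈ᴹ-setoid

  ⟨,⟩-zeroˡ : ∀ y → ⟨ 0ᴹ , y ⟩ ≈ 0#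
  ⟨,⟩-zeroˡ y = begin
    ⟨ 0ᴹ , y ⟩       ≈⟨ ⟨,⟩-cong (*ₗ-zeroˡ 0ᴹ) ≈ᴹ-refl ⟨
    ⟨ 0# *ₗ 0ᴹ , y ⟩ ≈⟨ ⟨,⟩-*ˡ 0# 0ᴹ y ⟩
    0# * ⟨ 0ᴹ , y ⟩  ≈⟨ zeroˡ _ ⟩
    0#               ∎
    where open ≈-Reasoning setoid

  ⟨,⟩-negˡ : ∀ x y → ⟨ -ᴹ x , y ⟩ ≈ - ⟨ x , y ⟩
  ⟨,⟩-negˡ x y = +-inverseʳ-unique _ _ (begin
    ⟨ x , y ⟩ + ⟨ -ᴹ x , y ⟩ ≈⟨ ⟨,⟩-+ˡ x (-ᴹ x) y ⟨
    ⟨ x +ᴹ -ᴹ x , y ⟩        ≈⟨ ⟨,⟩-cong (-ᴹ‿inverseʳ x) ≈ᴹ-refl ⟩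
    ⟨ 0ᴹ , y ⟩               ≈⟨ ⟨,⟩-zeroˡ y ⟩
    0#                       ∎)
    where open ≈-Reasoning setoid

  -- The pairing of x with the coroot of β, 2⟨x,β⟩/⟨β,β⟩: the coefficient of β that `reflect`
  -- subtracts.
  coroot : Carrierᴹ → Carrierᴹ → Carrier
  coroot β x = ((1# + 1#) * ⟨ x , β ⟩) * ⟨ β , β ⟩ ⁻¹

  coroot-cong : ∀ {β γ x y} → β ≈ᴹ γ → x ≈ᴹ y → coroot β x ≈ coroot γ y
  coroot-cong β≈γ x≈y =
    *-cong (*-congˡ (⟨,⟩-cong x≈y β≈γ)) (⁻¹-cong (⟨,⟩-cong β≈γ β≈γ))

  coroot-+ : ∀ β x y → coroot β (x +ᴹ y) ≈ coroot β x + coroot β y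
  coroot-+ β x y = begin
    (_ * ⟨ x +ᴹ y , β ⟩) * _            ≈⟨ *-congʳ (*-congˡ (⟨,⟩-+ˡ x y β)) ⟩
    (_ * (⟨ x , β ⟩ + ⟨ y , β ⟩)) * _   ≈⟨ *-congʳ (distribˡ _ _ _) ⟩
    (_ * ⟨ x , β ⟩ + _ * ⟨ y , β ⟩) * _ ≈⟨ distribʳ _ _ _ ⟩
    coroot β x + coroot β y             ∎
    where open ≈-Reasoning setoid

  coroot-*ₗ : ∀ β a x → coroot β (a *ₗ x) ≈ a * coroot β x
  coroot-*ₗ β a x = begin
    (_ * ⟨ a *ₗ x , β ⟩) * _  ≈⟨ *-congʳ (*-congˡ (⟨,⟩-*ˡ a x β)) ⟩
    (_ * (a * ⟨ x , β ⟩)) * _ ≈⟨ *-congʳ (*ᴷ.x∙yz≈y∙xz _ _ _) ⟩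
    (a * (_ * ⟨ x , β ⟩)) * _ ≈⟨ *-assoc _ _ _ ⟩
    a * coroot β x            ∎
    where open ≈-Reasoning setoid

  coroot-self : ∀ {β} → ¬ (β ≈ᴹ 0ᴹ) → coroot β β ≈ 1# + 1#
  coroot-self {β} β≉0 = begin
    (_ * ⟨ β , β ⟩) * ⟨ β , β ⟩ ⁻¹ ≈⟨ *-assoc _ _ _ ⟩
    _ * (⟨ β , β ⟩ * ⟨ β , β ⟩ ⁻¹) ≈⟨ *-congˡ (*-inverseʳ (<⇒≉0 (⟨,⟩-posdef β β≉0))) ⟩
    _ * 1#                         ≈⟨ *-identityʳ _ ⟩
    1# + 1#                        ∎
    where open ≈-Reasoning setoid

  reflect-cong : ∀ {β γ x y} → β ≈ᴹ γ → x ≈ᴹ y → reflect β x ≈ᴹ reflect γ y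
  reflect-cong β≈γ x≈y =
    +ᴹ-cong x≈y (-ᴹ‿cong (*ₗ-cong (coroot-cong β≈γ x≈y) β≈γ))

  reflect-+ : ∀ β x y → reflect β (x +ᴹ y) ≈ᴹ reflect β x +ᴹ reflect β y
  reflect-+ β x y = begin
    x +ᴹ y +ᴹ -ᴹ (_ *ₗ β)                    ≈⟨ +ᴹ-congˡ (-ᴹ‿cong (*ₗ-congʳ (coroot-+ β x y))) ⟩
    x +ᴹ y +ᴹ -ᴹ ((_ + _) *ₗ β)              ≈⟨ +ᴹ-congˡ (-ᴹ‿cong (*ₗ-distribʳ β _ _)) ⟩
    x +ᴹ y +ᴹ -ᴹ (_ *ₗ β +ᴹ _ *ₗ β)          ≈⟨ +ᴹ-congˡ (-ᴹ-+ᴹ-comm _ _) ⟨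
    x +ᴹ y +ᴹ (-ᴹ (_ *ₗ β) +ᴹ -ᴹ (_ *ₗ β))   ≈⟨ +ᴹ.interchange _ _ _ _ ⟩
    reflect β x +ᴹ reflect β y               ∎
    where open ≈-Reasoning ≈ᴹ-setoid

  reflect-*ₗ : ∀ β a x → reflect β (a *ₗ x) ≈ᴹ a *ₗ reflect β x
  reflect-*ₗ β a x = begin
    a *ₗ x +ᴹ -ᴹ (_ *ₗ β)          ≈⟨ +ᴹ-congˡ (-ᴹ‿cong (*ₗ-congʳ (coroot-*ₗ β a x))) ⟩
    a *ₗ x +ᴹ -ᴹ ((a * _) *ₗ β)    ≈⟨ +ᴹ-congˡ (-ᴹ‿cong (*ₗ-assoc a _ β)) ⟩
    a *ₗ x +ᴹ -ᴹ (a *ₗ (_ *ₗ β))   ≈⟨ +ᴹ-congˡ (*ₗ-neg a _) ⟨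
    a *ₗ x +ᴹ a *ₗ -ᴹ (_ *ₗ β)     ≈⟨ *ₗ-distribˡ a _ _ ⟨
    a *ₗ reflect β x               ∎
    where open ≈-Reasoning ≈ᴹ-setoid

  reflect-neg : ∀ β x → reflect β (-ᴹ x) ≈ᴹ -ᴹ reflect β x
  reflect-neg β x = inverseˡ-uniqueᴹ _ _ (begin
    reflect β (-ᴹ x) +ᴹ reflect β x ≈⟨ reflect-+ β (-ᴹ x) x ⟨
    -- Zero is written as `0# *ₗ 0ᴹ`, so that homogeneity makes its reflection vanish.
    reflect β (-ᴹ x +ᴹ x)           ≈⟨ reflect-cong ≈ᴹ-refl (≈ᴹ-trans (-ᴹ‿inverseˡ x)
                                         (≈ᴹ-sym (*ₗ-zeroˡ 0ᴹ))) ⟩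
    reflect β (0# *ₗ 0ᴹ)            ≈⟨ reflect-*ₗ β 0# 0ᴹ ⟩
    0# *ₗ reflect β 0ᴹ              ≈⟨ *ₗ-zeroˡ _ ⟩
    0ᴹ                              ∎)
    where open ≈-Reasoning ≈ᴹ-setoid

  reflect-self : ∀ {β} → ¬ (β ≈ᴹ 0ᴹ) → reflect β β ≈ᴹ -ᴹ β
  reflect-self {β} β≉0 = inverseʳ-uniqueᴹ _ _ (begin
    β +ᴹ reflect β β                     ≈⟨ +ᴹ-assoc _ _ _ ⟨
    β +ᴹ β +ᴹ -ᴹ (coroot β β *ₗ β)       ≈⟨ +ᴹ-congˡ (-ᴹ‿cong (*ₗ-congʳ (coroot-self β≉0))) ⟩
    β +ᴹ β +ᴹ -ᴹ ((1# + 1#) *ₗ β)        ≈⟨ +ᴹ-congˡ (-ᴹ‿cong (*ₗ-distribʳ β 1# 1#)) ⟩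
    β +ᴹ β +ᴹ -ᴹ (1# *ₗ β +ᴹ 1# *ₗ β)    ≈⟨ +ᴹ-congˡ (-ᴹ‿cong (+ᴹ-cong (*ₗ-identityˡ β) (*ₗ-identityˡ β))) ⟩
    β +ᴹ β +ᴹ -ᴹ (β +ᴹ β)                ≈⟨ -ᴹ‿inverseʳ _ ⟩
    0ᴹ                                   ∎)
    where open ≈-Reasoning ≈ᴹ-setoid

  reflect-involutive : ∀ {β} → ¬ (β ≈ᴹ 0ᴹ) → ∀ x → reflect β (reflect β x) ≈ᴹ x
  reflect-involutive {β} β≉0 x = begin
    reflect β (x +ᴹ -ᴹ (k *ₗ β))           ≈⟨ reflect-+ β x _ ⟩
    reflect β x +ᴹ reflect β (-ᴹ (k *ₗ β)) ≈⟨ +ᴹ-congˡ (reflect-neg β _) ⟩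
    reflect β x +ᴹ -ᴹ reflect β (k *ₗ β)   ≈⟨ +ᴹ-congˡ (-ᴹ‿cong (reflect-*ₗ β k β)) ⟩
    reflect β x +ᴹ -ᴹ (k *ₗ reflect β β)   ≈⟨ +ᴹ-congˡ (-ᴹ‿cong (*ₗ-congˡ (reflect-self β≉0))) ⟩
    reflect β x +ᴹ -ᴹ (k *ₗ (-ᴹ β))        ≈⟨ +ᴹ-congˡ (-ᴹ‿cong (*ₗ-neg k β)) ⟩
    reflect β x +ᴹ -ᴹ (-ᴹ (k *ₗ β))        ≈⟨ +ᴹ-congˡ (-ᴹ-involutive _) ⟩
    x +ᴹ -ᴹ (k *ₗ β) +ᴹ k *ₗ β             ≈⟨ +ᴹ-assoc _ _ _ ⟩
    x +ᴹ (-ᴹ (k *ₗ β) +ᴹ k *ₗ β)           ≈⟨ +ᴹ-congˡ (-ᴹ‿inverseˡ _) ⟩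
    x +ᴹ 0ᴹ                                ≈⟨ +ᴹ-identityʳ x ⟩
    x                                      ∎
    where
    open ≈-Reasoning ≈ᴹ-setoid
    k = coroot β x

  -- By `expand`, the left side is ⟨x,y⟩ minus a multiple of ⟨x,β⟩⟨β,y⟩, which is symmetric in x and
  -- y.
  reflect-adjoint : ∀ β x y → ⟨ reflect β x , y ⟩ ≈ ⟨ x , reflect β y ⟩
  reflect-adjoint β x y = begin
    ⟨ reflect β x , y ⟩                                  ≈⟨ expand x y ⟩
    ⟨ x , y ⟩ + - (((1# + 1#) * ⟨ x , β ⟩) * d * ⟨ β , y ⟩) ≈⟨ +-cong (⟨,⟩-comm x y) (-‿cong swap) ⟩
    ⟨ y , x ⟩ + - (((1# + 1#) * ⟨ y , β ⟩) * d * ⟨ β , x ⟩) ≈⟨ expand y x ⟨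
    ⟨ reflect β y , x ⟩                                  ≈⟨ ⟨,⟩-comm _ _ ⟩
    ⟨ x , reflect β y ⟩                                  ∎
    where
    open ≈-Reasoning setoid
    d = ⟨ β , β ⟩ ⁻¹
    expand : ∀ x y → ⟨ reflect β x , y ⟩ ≈
                     ⟨ x , y ⟩ + - (((1# + 1#) * ⟨ x , β ⟩) * d * ⟨ β , y ⟩)
    expand x y = trans (⟨,⟩-+ˡ _ _ _)
      (+-congˡ (trans (⟨,⟩-negˡ _ _) (-‿cong (⟨,⟩-*ˡ _ _ _))))
    swap : ((1# + 1#) * ⟨ x , β ⟩) * d * ⟨ β , y ⟩ ≈ ((1# + 1#) * ⟨ y , β ⟩) * d * ⟨ β , x ⟩
    swap = begin
      ((1# + 1#) * ⟨ x , β ⟩) * d * ⟨ β , y ⟩ ≈⟨ *ᴷ.xy∙z≈xz∙y _ _ _ ⟩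
      ((1# + 1#) * ⟨ x , β ⟩) * ⟨ β , y ⟩ * d ≈⟨ *-congʳ (*ᴷ.xy∙z≈xz∙y _ _ _) ⟩
      ((1# + 1#) * ⟨ β , y ⟩) * ⟨ x , β ⟩ * d ≈⟨ *ᴷ.xy∙z≈xz∙y _ _ _ ⟩
      ((1# + 1#) * ⟨ β , y ⟩) * d * ⟨ x , β ⟩
        ≈⟨ *-cong (*-congʳ (*-congˡ (⟨,⟩-comm _ _))) (⟨,⟩-comm _ _) ⟩
      ((1# + 1#) * ⟨ y , β ⟩) * d * ⟨ β , x ⟩ ∎

  -- A self-adjoint involution preserves the form.
  reflect-isometry : ∀ {β} → ¬ (β ≈ᴹ 0ᴹ) → ∀ x y → ⟨ reflect β x , reflect β y ⟩ ≈ ⟨ x , y ⟩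
  reflect-isometry β≉0 x y =
    trans (reflect-adjoint _ _ _) (⟨,⟩-cong ≈ᴹ-refl (reflect-involutive β≉0 y))

  coroot-reflect : ∀ {β} → ¬ (β ≈ᴹ 0ᴹ) → ∀ γ x → coroot (reflect β γ) (reflect β x) ≈ coroot γ x
  coroot-reflect β≉0 γ x =
    *-cong (*-congˡ (reflect-isometry β≉0 x γ)) (⁻¹-cong (reflect-isometry β≉0 γ γ))

  -- An isometry carries the reflection in γ to the reflection in the image of γ. This moves a
  -- reflection past the letters of a word.
  reflect-reflect : ∀ {β} → ¬ (β ≈ᴹ 0ᴹ) → ∀ γ x →
                    reflect β (reflect γ x) ≈ᴹ reflect (reflect β γ) (reflect β x)
  reflect-reflect {β} β≉0 γ x = begin
    reflect β (x +ᴹ -ᴹ (coroot γ x *ₗ γ))           ≈⟨ reflect-+ β x _ ⟩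
    reflect β x +ᴹ reflect β (-ᴹ (coroot γ x *ₗ γ)) ≈⟨ +ᴹ-congˡ (reflect-neg β _) ⟩
    reflect β x +ᴹ -ᴹ reflect β (coroot γ x *ₗ γ)   ≈⟨ +ᴹ-congˡ (-ᴹ‿cong (reflect-*ₗ β _ γ)) ⟩
    reflect β x +ᴹ -ᴹ (coroot γ x *ₗ reflect β γ)
      ≈⟨ +ᴹ-congˡ (-ᴹ‿cong (*ₗ-congʳ (coroot-reflect β≉0 γ x))) ⟨
    reflect (reflect β γ) (reflect β x)             ∎
    where open ≈-Reasoning ≈ᴹ-setoid

-- Simple roots and reduced expressions

module ReflectionActionProperties {𝒲 : FiniteCoxeterSystem w ℓw} {K : OrderedField c ℓ₁ ℓ₂}
       {V : EuclideanSpace K v ℓv} (𝒜 : ReflectionAction 𝒲 V) where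
  private module K = OrderedField K
  open OrderedFieldProperties K
  open EuclideanSpace V
  open EuclideanSpaceProperties V
  private module W = FiniteCoxeterSystem 𝒲
  open W using (rank; simple; product; _∙_; ε) renaming (_≈_ to _≈ʷ_)
  open ReflectionAction 𝒜
  open IsRootSystem isRootSystem
  open IsSimpleSystem isSimpleSystem
  open Membership ≈ᴹ-setoid using () renaming (_∈_ to _∈ᴹ_)

  Pos Neg : Carrierᴹ → Set _
  Pos = NonnegativeCombination α
  Neg β = Pos (-ᴹ β)

  Pos-cong : ∀ {β γ} → β ≈ᴹ γ → Pos β → Pos γ
  Pos-cong β≈γ (a , a≥0 , β≈a) = a , a≥0 , ≈ᴹ-trans (≈ᴹ-sym β≈γ) β≈a

  Pos⇒Neg- : ∀ {β} → Pos β → Neg (-ᴹ β)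
  Pos⇒Neg- = Pos-cong (≈ᴹ-sym (-ᴹ-involutive _))

  α-pos : ∀ s → Pos (α s)
  α-pos s = a , a≥0 , ≈ᴹ-sym (begin
    lincomb a α    ≈⟨ lincomb-single a α s a-off ⟩
    a s *ₗ α s     ≈⟨ *ₗ-congʳ a-on ⟩
    K.1# *ₗ α s    ≈⟨ *ₗ-identityˡ _ ⟩
    α s            ∎)
    where
    open ≈-Reasoning ≈ᴹ-setoid
    a : Fin rank → K.Carrier
    a i = if does (i ≟ s) then K.1# else K.0#
    a≥0 : ∀ i → K.0# K.≤ a i
    a≥0 i with i ≟ s
    ... | yes _ = inj₁ K.0<1
    ... | no  _ = inj₂ K.refl
    a-off : ∀ i → i ≢ s → a i K.≈ K.0#
    a-off i i≢s with i ≟ s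
    ... | yes i≡s = contradiction i≡s i≢s
    ... | no  _   = K.refl
    a-on : a s K.≈ K.1#
    a-on with s ≟ s
    ... | yes _   = K.refl
    ... | no  s≢s = contradiction ≡.refl s≢s

  α-nonzero : ∀ s → ¬ (α s ≈ᴹ 0ᴹ)
  α-nonzero s = nonzero (isRoot s)

  -- The two combinations add up to zero, so by independence each a i + b i vanishes. Nonnegative
  -- summands then vanish separately, but a root is nonzero.
  Pos-Neg-contradiction : ∀ {β} → β ∈ᴹ Φ → Pos β → Neg β → ⊥
  Pos-Neg-contradiction {β} β∈Φ (a , a≥0 , β≈a) (b , b≥0 , -β≈b) =
    nonzero β∈Φ (≈ᴹ-trans β≈a (lincomb-zero a α λ i →
      +-nonneg-zeroˡ (a≥0 i) (b≥0 i) (independent _ a+b≈0 i)))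
    where
    open ≈-Reasoning ≈ᴹ-setoid
    a+b≈0 : lincomb (λ i → a i K.+ b i) α ≈ᴹ 0ᴹ
    a+b≈0 = begin
      lincomb (λ i → a i K.+ b i) α ≈⟨ lincomb-+ a b α ⟩
      lincomb a α +ᴹ lincomb b α    ≈⟨ +ᴹ-cong β≈a -β≈b ⟨
      β +ᴹ -ᴹ β                     ≈⟨ -ᴹ‿inverseʳ β ⟩
      0ᴹ                            ∎

  ∈Φ-cong : ∀ {β γ} → β ≈ᴹ γ → β ∈ᴹ Φ → γ ∈ᴹ Φ
  ∈Φ-cong = Membershipₚ.∈-resp-≈ ≈ᴹ-setoid

  reflect-α-cong : ∀ s {x y} → x ≈ᴹ y → reflect (α s) x ≈ᴹ reflect (α s) y
  reflect-α-cong s = reflect-cong ≈ᴹ-refl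

  reflect-α-self : ∀ s → reflect (α s) (α s) ≈ᴹ -ᴹ α s
  reflect-α-self s = reflect-self (α-nonzero s)

  reflect-α-involutive : ∀ s x → reflect (α s) (reflect (α s) x) ≈ᴹ x
  reflect-α-involutive s = reflect-involutive (α-nonzero s)

  reflect-∈Φ : ∀ s {β} → β ∈ᴹ Φ → reflect (α s) β ∈ᴹ Φ
  reflect-∈Φ s = stable (isRoot s)

  neg-∈Φ : ∀ {β} → β ∈ᴹ Φ → (-ᴹ β) ∈ᴹ Φ
  neg-∈Φ β∈Φ = ∈Φ-cong (reflect-self (nonzero β∈Φ)) (stable β∈Φ β∈Φ)

  -- If β and -sβ = -β + k αₛ are nonnegative combinations, then their sum
  -- k αₛ shows that β has no coordinate other than the one at s.
  Pos-Neg-reflect⇒≈α : ∀ s {β} → β ∈ᴹ Φ → Pos β → Neg (reflect (α s) β) → β ≈ᴹ α s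
  Pos-Neg-reflect⇒≈α s {β} β∈Φ (a , a≥0 , β≈a) (b , b≥0 , -sβ≈b) = begin
    β             ≈⟨ β≈aₛαₛ ⟩
    a s *ₗ α s    ≈⟨ *ₗ-congʳ aₛ≈1 ⟩
    K.1# *ₗ α s   ≈⟨ *ₗ-identityˡ _ ⟩
    α s           ∎
    where
    open ≈-Reasoning ≈ᴹ-setoid
    k : K.Carrier
    k = coroot (α s) β
    d : Fin rank → K.Carrier
    d i = if does (i ≟ s) then K.- k else K.0#
    d-off : ∀ i → i ≢ s → d i K.≈ K.0#
    d-off i i≢s with i ≟ s
    ... | yes i≡s = contradiction i≡s i≢s
    ... | no  _   = K.refl
    d-on : d s K.≈ K.- k
    d-on with s ≟ s
    ... | yes _   = K.refl
    ... | no  s≢s = contradiction ≡.refl s≢s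
    a+b+d≈0 : lincomb (λ i → a i K.+ b i K.+ d i) α ≈ᴹ 0ᴹ
    a+b+d≈0 = begin
      lincomb (λ i → a i K.+ b i K.+ d i) α ≈⟨ lincomb-+ _ d α ⟩
      lincomb (λ i → a i K.+ b i) α +ᴹ lincomb d α ≈⟨ +ᴹ-cong (lincomb-+ a b α) (lincomb-single d α s d-off) ⟩
      lincomb a α +ᴹ lincomb b α +ᴹ d s *ₗ α s
        ≈⟨ +ᴹ-cong (+ᴹ-cong (≈ᴹ-sym β≈a) (≈ᴹ-sym -sβ≈b)) (*ₗ-congʳ d-on) ⟩
      β +ᴹ -ᴹ (β +ᴹ -ᴹ (k *ₗ α s)) +ᴹ (K.- k) *ₗ α s
        ≈⟨ +ᴹ-congʳ (+ᴹ-congˡ (-ᴹ-+ᴹ-comm _ _)) ⟨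
      β +ᴹ (-ᴹ β +ᴹ -ᴹ (-ᴹ (k *ₗ α s))) +ᴹ (K.- k) *ₗ α s
        ≈⟨ +ᴹ-congʳ (+ᴹ-assoc _ _ _) ⟨
      β +ᴹ -ᴹ β +ᴹ -ᴹ (-ᴹ (k *ₗ α s)) +ᴹ (K.- k) *ₗ α s
        ≈⟨ +ᴹ-congʳ (+ᴹ-cong (-ᴹ‿inverseʳ β) (-ᴹ-involutive _)) ⟩
      0ᴹ +ᴹ k *ₗ α s +ᴹ (K.- k) *ₗ α s    ≈⟨ +ᴹ-congʳ (+ᴹ-identityˡ _) ⟩
      k *ₗ α s +ᴹ (K.- k) *ₗ α s          ≈⟨ *ₗ-distribʳ _ _ _ ⟨
      (k K.+ K.- k) *ₗ α s                ≈⟨ *ₗ-congʳ (K.-‿inverseʳ k) ⟩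
      K.0# *ₗ α s                         ≈⟨ *ₗ-zeroˡ _ ⟩
      0ᴹ                                  ∎
    a-off : ∀ i → i ≢ s → a i K.≈ K.0#
    a-off i i≢s = +-nonneg-zeroˡ (a≥0 i) (b≥0 i)
      (K.trans (K.sym (K.+-identityʳ _))
        (K.trans (K.+-congˡ (K.sym (d-off i i≢s))) (independent _ a+b+d≈0 i)))
    β≈aₛαₛ : β ≈ᴹ a s *ₗ α s
    β≈aₛαₛ = ≈ᴹ-trans β≈a (lincomb-single a α s a-off)
    -- The only multiples of `α s` that are roots are `α s` and its negative; nonnegativity of the
    -- coefficient leaves the first.
    aₛ≈1 : a s K.≈ K.1#
    aₛ≈1 with Equivalence.to (reduced (isRoot s) (a s)) (∈Φ-cong β≈aₛαₛ β∈Φ)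
    ... | inj₁ aₛ≈1  = aₛ≈1
    ... | inj₂ aₛ≈-1 = contradiction (≤-respʳ aₛ≈-1 (a≥0 s)) 0≰-1

  Neg-Pos-reflect⇒≈-α : ∀ s {β} → β ∈ᴹ Φ → Neg β → Pos (reflect (α s) β) → β ≈ᴹ -ᴹ α s
  Neg-Pos-reflect⇒≈-α s {β} β∈Φ β<0 sβ>0 = begin
    β           ≈⟨ -ᴹ-involutive β ⟨
    -ᴹ (-ᴹ β)   ≈⟨ -ᴹ‿cong (Pos-Neg-reflect⇒≈α s (neg-∈Φ β∈Φ) β<0
                     (Pos-cong (≈ᴹ-sym (≈ᴹ-trans (-ᴹ‿cong (reflect-neg _ _)) (-ᴹ-involutive _))) sβ>0)) ⟩
    -ᴹ α s      ∎
    where open ≈-Reasoning ≈ᴹ-setoid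

  -- Equations in W are proved through this action, which computes letter by letter;
  -- `act-≈⇒product-≈` returns to W.
  act : List (Fin rank) → Carrierᴹ → Carrierᴹ
  act u x = foldr (λ s → reflect (α s)) x u

  product-▷ : ∀ u x → product u ▷ x ≈ᴹ act u x
  product-▷ []      x = ▷-identity x
  product-▷ (s ∷ u) x = ≈ᴹ-trans (▷-assoc _ _ _)
    (≈ᴹ-trans (▷-simple s _) (reflect-α-cong s (product-▷ u x)))

  act-neg : ∀ u x → act u (-ᴹ x) ≈ᴹ -ᴹ act u x
  act-neg []      x = ≈ᴹ-refl
  act-neg (s ∷ u) x = ≈ᴹ-trans (reflect-α-cong s (act-neg u x)) (reflect-neg _ _)

  act-∈Φ : ∀ u {β} → β ∈ᴹ Φ → act u β ∈ᴹ Φ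
  act-∈Φ []      β∈Φ = β∈Φ
  act-∈Φ (s ∷ u) β∈Φ = reflect-∈Φ s (act-∈Φ u β∈Φ)

  product-≈⇒act-≈ : ∀ u v → product u ≈ʷ product v → ∀ x → act u x ≈ᴹ act v x
  product-≈⇒act-≈ u v u≈v x =
    ≈ᴹ-trans (≈ᴹ-sym (product-▷ u x)) (≈ᴹ-trans (▷-cong u≈v ≈ᴹ-refl) (product-▷ v x))

  -- The product v⁻¹u acts trivially, so it is the identity by faithfulness. Uniqueness of inverses
  -- then gives u = (v⁻¹)⁻¹.
  act-≈⇒product-≈ : ∀ u v → (∀ x → act u x ≈ᴹ act v x) → product u ≈ʷ product v
  act-≈⇒product-≈ u v u≈v =
    W.trans (inverseʳ-unique _ _ (▷-faithful (product v W.⁻¹ ∙ product u) trivial))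
            (⁻¹-involutive _)
    where
    open GroupProperties W.group using (inverseʳ-unique; ⁻¹-involutive)
    open ≈-Reasoning ≈ᴹ-setoid
    trivial : ∀ x → (product v W.⁻¹ ∙ product u) ▷ x ≈ᴹ x
    trivial x = begin
      (product v W.⁻¹ ∙ product u) ▷ x ≈⟨ ▷-assoc _ _ _ ⟩
      product v W.⁻¹ ▷ product u ▷ x   ≈⟨ ▷-cong W.refl (≈ᴹ-trans (product-▷ u x)
                                            (≈ᴹ-trans (u≈v x) (≈ᴹ-sym (product-▷ v x)))) ⟩
      product v W.⁻¹ ▷ product v ▷ x   ≈⟨ ▷-assoc _ _ _ ⟨
      (product v W.⁻¹ ∙ product v) ▷ x ≈⟨ ▷-cong (W.inverseˡ _) ≈ᴹ-refl ⟩
      ε ▷ x                            ≈⟨ ▷-identity x ⟩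
      x                                ∎

  -- The preimage is the image of β under the inverse element; choosing a word for that element
  -- shows that it lies in `Φ`.
  act-surjective : ∀ u {β} → β ∈ᴹ Φ → ∃[ γ ] γ ∈ᴹ Φ × act u γ ≈ᴹ β
  act-surjective u {β} β∈Φ with W.generated (product u W.⁻¹)
  ... | v , v≈u⁻¹ = act v β , act-∈Φ v β∈Φ , (begin
    act u (act v β)               ≈⟨ product-▷ u _ ⟨
    product u ▷ act v β           ≈⟨ ▷-cong W.refl (product-▷ v β) ⟨
    product u ▷ product v ▷ β     ≈⟨ ▷-assoc _ _ _ ⟨
    (product u ∙ product v) ▷ β   ≈⟨ ▷-cong (W.trans (W.∙-congˡ v≈u⁻¹) (W.inverseʳ _)) ≈ᴹ-refl ⟩
    ε ▷ β                         ≈⟨ ▷-identity β ⟩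
    β                             ∎)
    where open ≈-Reasoning ≈ᴹ-setoid

  -- The words `s ∷ s ∷ u` and `u` act alike because a reflection is an involution; x is replaced by
  -- a word u so that this applies.
  simple-involutive : ∀ s x → simple s ∙ (simple s ∙ x) ≈ʷ x
  simple-involutive s x with W.generated x
  ... | u , u≈x = begin
    simple s ∙ (simple s ∙ x) ≈⟨ W.∙-congˡ (W.∙-congˡ u≈x) ⟨
    product (s ∷ s ∷ u)       ≈⟨ act-≈⇒product-≈ (s ∷ s ∷ u) u (λ y → reflect-α-involutive s _) ⟩
    product u                 ≈⟨ u≈x ⟩
    x                         ∎
    where open ≈-Reasoning W.setoid

  -- Prefixing s turns an expression of sρ into one of ρ with one letter more, so a shorter
  -- expression of sρ would yield a shorter one of ρ.
  ReducedExpression-tail : ∀ {ρ} s u → W.ReducedExpression ρ (s ∷ u) →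
                           W.ReducedExpression (simple s ∙ ρ) u
  ReducedExpression-tail {ρ} s u (su≈ρ , su-min) =
    W.trans (W.sym (simple-involutive s _)) (W.∙-congˡ su≈ρ) ,
    λ v v≈sρ → ℕ.s≤s⁻¹ (su-min (s ∷ v) (W.trans (W.∙-congˡ v≈sρ) (simple-involutive s ρ)))

  ReducedExpression-≤ : ∀ {ρ} u u′ → W.ReducedExpression ρ u → product u′ ≈ʷ ρ →
                        length u′ ℕ.≤ length u → W.ReducedExpression ρ u′
  ReducedExpression-≤ u u′ (_ , u-min) u′≈ρ u′≤u =
    u′≈ρ , λ v v≈ρ → ℕₚ.≤-trans u′≤u (u-min v v≈ρ)

  ReducedExpression-cons : ∀ {ρ} s u u′ → W.ReducedExpression ρ (s ∷ u) →
                           W.ReducedExpression (simple s ∙ ρ) u′ → W.ReducedExpression ρ (s ∷ u′)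
  ReducedExpression-cons {ρ} s u u′ su-red (u′≈sρ , u′-min) =
    ReducedExpression-≤ (s ∷ u) (s ∷ u′) su-red
      (W.trans (W.∙-congˡ u′≈sρ) (simple-involutive s ρ))
      (ℕ.s≤s (u′-min u (proj₁ (ReducedExpression-tail s u su-red))))

  -- An expression of sρ is at most one letter shorter than a reduced one of ρ, and u′ attains this
  -- bound.
  ReducedExpression-descent : ∀ {ρ} s u u′ → W.ReducedExpression ρ u → product u′ ≈ʷ simple s ∙ ρ →
                              length u ≡ ℕ.suc (length u′) → W.ReducedExpression (simple s ∙ ρ) u′
  ReducedExpression-descent {ρ} s u u′ (u≈ρ , u-min) u′≈sρ ∣u∣≡1+∣u′∣ = u′≈sρ , λ v v≈sρ →
    ℕ.s≤s⁻¹ (ℕₚ.≤-trans (ℕₚ.≤-reflexive (≡.sym ∣u∣≡1+∣u′∣))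
      (u-min (s ∷ v) (W.trans (W.∙-congˡ v≈sρ) (simple-involutive s ρ))))

  ReducedExpression-cong : ∀ {ρ ρ′} u → ρ ≈ʷ ρ′ → W.ReducedExpression ρ u → W.ReducedExpression ρ′ u
  ReducedExpression-cong u ρ≈ρ′ (u≈ρ , u-min) =
    W.trans u≈ρ ρ≈ρ′ , λ v v≈ρ′ → u-min v (W.trans v≈ρ′ (W.sym ρ≈ρ′))

-- Root functions, flips and greedy facets

module SubwordComplexProperties {𝒲 : FiniteCoxeterSystem w ℓw} {K : OrderedField c ℓ₁ ℓ₂}
       {V : EuclideanSpace K v ℓv} (𝒜 : ReflectionAction 𝒲 V) where
  open EuclideanSpace V
  open EuclideanSpaceProperties V
  private module W = FiniteCoxeterSystem 𝒲
  open W using (rank; simple; product; _∙_) renaming (_≈_ to _≈ʷ_)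
  open ReflectionAction 𝒜
  open ReflectionActionProperties 𝒜
  open IsSimpleSystem isSimpleSystem
  open SubwordComplex 𝒲
  open Membership ≈ᴹ-setoid using () renaming (_∈_ to _∈ᴹ_)

  -- The root function by recursion on the word, where a leading letter outside the facet reflects
  -- all later roots; `rootFunction≈root` identifies it with the one in the theorem.
  root : ∀ {m} → Word m → Subset m → Fin m → Carrierᴹ
  root (q ∷ Q) (b ∷ I)       zero    = α q
  root (q ∷ Q) (inside ∷ I)  (suc k) = root Q I k
  root (q ∷ Q) (outside ∷ I) (suc k) = reflect (α q) (root Q I k)

  root-∈Φ : ∀ {m} (Q : Word m) I k → root Q I k ∈ᴹ Φ
  root-∈Φ (q ∷ Q) (b ∷ I)       zero    = isRoot q
  root-∈Φ (q ∷ Q) (inside ∷ I)  (suc k) = root-∈Φ Q I k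
  root-∈Φ (q ∷ Q) (outside ∷ I) (suc k) = reflect-∈Φ q (root-∈Φ Q I k)

  facetWord : ∀ {m} → Word m → Subset m → List (Fin rank)
  facetWord Q I = subword Q (∁ I)

  length-facetWord : ∀ {m} (Q : Word m) I x →
                     length (facetWord Q (I [ x ]≔ outside)) ≡ ℕ.suc (length (facetWord Q (I [ x ]≔ inside)))
  length-facetWord (q ∷ Q) (b ∷ I)       zero    = ≡.refl
  length-facetWord (q ∷ Q) (inside ∷ I)  (suc x) = length-facetWord Q I x
  length-facetWord (q ∷ Q) (outside ∷ I) (suc x) = ≡.cong ℕ.suc (length-facetWord Q I x)

  -- The letter at x enters the word as the reflection in its simple root. Moving it to the front
  -- past the earlier letters conjugates it into the reflection in the root at x.
  act-facetWord : ∀ {m} (Q : Word m) I x y → act (facetWord Q (I [ x ]≔ outside)) y ≈ᴹ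
                  reflect (root Q I x) (act (facetWord Q (I [ x ]≔ inside)) y)
  act-facetWord (q ∷ Q) (b ∷ I)       zero    y = ≈ᴹ-refl
  act-facetWord (q ∷ Q) (inside ∷ I)  (suc x) y = act-facetWord Q I x y
  act-facetWord (q ∷ Q) (outside ∷ I) (suc x) y =
    ≈ᴹ-trans (reflect-α-cong q (act-facetWord Q I x y)) (reflect-reflect (α-nonzero q) _ _)

  root-≤ : ∀ {m} (Q : Word m) I x b k → ¬ (x Fin.< k) → root Q (I [ x ]≔ b) k ≡ root Q I k
  root-≤ (q ∷ Q) (b′ ∷ I)      zero    b zero    x≮k = ≡.refl
  root-≤ (q ∷ Q) (b′ ∷ I)      zero    b (suc k) x≮k = contradiction z<s x≮k
  root-≤ (q ∷ Q) (b′ ∷ I)      (suc x) b zero    x≮k = ≡.refl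
  root-≤ (q ∷ Q) (inside ∷ I)  (suc x) b (suc k) x≮k = root-≤ Q I x b k (x≮k ∘ s<s)
  root-≤ (q ∷ Q) (outside ∷ I) (suc x) b (suc k) x≮k =
    ≡.cong (reflect (α q)) (root-≤ Q I x b k (x≮k ∘ s<s))

  root-> : ∀ {m} (Q : Word m) I x k → x Fin.< k →
           root Q (I [ x ]≔ outside) k ≈ᴹ reflect (root Q I x) (root Q (I [ x ]≔ inside) k)
  root-> (q ∷ Q) (b ∷ I)       zero    (suc k) x<k = ≈ᴹ-refl
  root-> (q ∷ Q) (inside ∷ I)  (suc x) (suc k) x<k = root-> Q I x k (s<s⁻¹ x<k)
  root-> (q ∷ Q) (outside ∷ I) (suc x) (suc k) x<k =
    ≈ᴹ-trans (reflect-α-cong q (root-> Q I x k (s<s⁻¹ x<k))) (reflect-reflect (α-nonzero q) _ _)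

  product-facetWord : ∀ {m} (Q : Word m) I x {s} → root Q I x ≈ᴹ α s →
                      product (facetWord Q (I [ x ]≔ outside)) ≈ʷ
                      simple s ∙ product (facetWord Q (I [ x ]≔ inside))
  product-facetWord Q I x {s} r≈α =
    act-≈⇒product-≈ (facetWord Q (I [ x ]≔ outside)) (s ∷ facetWord Q (I [ x ]≔ inside)) λ y →
      ≈ᴹ-trans (act-facetWord Q I x y) (reflect-cong r≈α ≈ᴹ-refl)

  -- The root at k starts as a simple root, so some earlier letter turns it from positive to
  -- negative. At that moment it is the simple root of that letter, and the letters further left
  -- carry the two opposite roots along.
  Neg⇒cancelling : ∀ {m} (Q : Word m) I k → Neg (root Q I k) →
                   ∃[ j ] j Fin.< k × I [ j ]= outside × root Q I j ≈ᴹ -ᴹ root Q I k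
  Neg⇒cancelling (q ∷ Q) (b ∷ I) zero α<0 = ⊥-elim (Pos-Neg-contradiction (isRoot q) (α-pos q) α<0)
  Neg⇒cancelling (q ∷ Q) (inside ∷ I) (suc k) r<0 with Neg⇒cancelling Q I k r<0
  ... | j , j<k , j∉I , rⱼ≈-r = suc j , s<s j<k , there j∉I , rⱼ≈-r
  Neg⇒cancelling (q ∷ Q) (outside ∷ I) (suc k) qr<0 with sign (root-∈Φ Q I k)
  ... | inj₁ r>0 = zero , z<s , here , (begin
      α q                           ≈⟨ -ᴹ-involutive _ ⟨
      -ᴹ (-ᴹ α q)                   ≈⟨ -ᴹ‿cong (reflect-α-self q) ⟨
      -ᴹ reflect (α q) (α q)        ≈⟨ -ᴹ‿cong (reflect-α-cong q
                                         (Pos-Neg-reflect⇒≈α q (root-∈Φ Q I k) r>0 qr<0)) ⟨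
      -ᴹ reflect (α q) (root Q I k) ∎)
    where open ≈-Reasoning ≈ᴹ-setoid
  ... | inj₂ r<0 with Neg⇒cancelling Q I k r<0
  ...   | j , j<k , j∉I , rⱼ≈-r =
        suc j , s<s j<k , there j∉I , ≈ᴹ-trans (reflect-α-cong q rⱼ≈-r) (reflect-neg _ _)

  -- The deletion condition: strip leading letters until the root at k becomes positive. The letter
  -- stripped last then cancels against the letter at k.
  Neg⇒shorter : ∀ {m} (Q : Word m) I k → I [ k ]= outside → Neg (root Q I k) →
                ∃[ u ] product u ≈ʷ product (facetWord Q I) × length u ℕ.< length (facetWord Q I)
  Neg⇒shorter (q ∷ Q) (b ∷ I) zero k∉I α<0 =
    ⊥-elim (Pos-Neg-contradiction (isRoot q) (α-pos q) α<0)
  Neg⇒shorter (q ∷ Q) (inside ∷ I) (suc k) (there k∉I) r<0 = Neg⇒shorter Q I k k∉I r<0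
  Neg⇒shorter (q ∷ Q) (outside ∷ I) (suc k) (there k∉I) qr<0 with sign (root-∈Φ Q I k)
  ... | inj₁ r>0 = facetWord Q (I [ k ]≔ inside) ,
        W.sym (W.trans (W.∙-congˡ (product-facetWord′ r≈α)) (simple-involutive q _)) ,
        ℕₚ.≤-trans (ℕₚ.n≤1+n _) (ℕₚ.≤-reflexive (≡.cong ℕ.suc
          (≡.trans (≡.sym (length-facetWord Q I k)) (≡.cong (length ∘ facetWord Q) ([]=⇒[]≔ I k∉I)))))
    where
    r≈α = Pos-Neg-reflect⇒≈α q (root-∈Φ Q I k) r>0 qr<0
    product-facetWord′ : root Q I k ≈ᴹ α q → product (facetWord Q I) ≈ʷ
                         simple q ∙ product (facetWord Q (I [ k ]≔ inside))
    product-facetWord′ r≈α =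
      ≡.subst (λ J → product (facetWord Q J) ≈ʷ simple q ∙ product (facetWord Q (I [ k ]≔ inside)))
        ([]=⇒[]≔ I k∉I) (product-facetWord Q I k r≈α)
  ... | inj₂ r<0 with Neg⇒shorter Q I k k∉I r<0
  ...   | u , u≈ , ∣u∣< = q ∷ u , W.∙-congˡ u≈ , s<s ∣u∣<

  facet-Pos : ∀ {m} (Q : Word m) I {ρ k} → IsFacet Q ρ I → I [ k ]= outside → Pos (root Q I k)
  facet-Pos Q I {k = k} (I≈ρ , I-min) k∉I with sign (root-∈Φ Q I k)
  ... | inj₁ r>0 = r>0
  ... | inj₂ r<0 with Neg⇒shorter Q I k k∉I r<0
  ...   | u , u≈I , ∣u∣<∣I∣ = contradiction (I-min u (W.trans u≈I I≈ρ)) (ℕₚ.<⇒≱ ∣u∣<∣I∣)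

  reflect-α-≈α : ∀ s {β} → β ≈ᴹ α s → reflect (α s) β ≈ᴹ -ᴹ α s
  reflect-α-≈α s β≈α = ≈ᴹ-trans (reflect-α-cong s β≈α) (reflect-α-self s)

  reflect-α-≈-α : ∀ s {β} → β ≈ᴹ -ᴹ α s → reflect (α s) β ≈ᴹ α s
  reflect-α-≈-α s β≈-α = begin
    reflect (α s) _          ≈⟨ reflect-α-cong s β≈-α ⟩
    reflect (α s) (-ᴹ α s)   ≈⟨ reflect-α-cong s (reflect-α-self s) ⟨
    reflect (α s) (reflect (α s) (α s)) ≈⟨ reflect-α-involutive s _ ⟩
    α s                      ∎
    where open ≈-Reasoning ≈ᴹ-setoid

  -α-not-Pos : ∀ s {β} → β ≈ᴹ -ᴹ α s → ¬ Pos β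
  -α-not-Pos s β≈-α β>0 =
    Pos-Neg-contradiction (isRoot s) (α-pos s) (Pos-cong β≈-α β>0)

  ≈-α⇒Neg : ∀ s {β} → β ≈ᴹ -ᴹ α s → Neg β
  ≈-α⇒Neg s β≈-α = Pos-cong (≈ᴹ-sym (≈ᴹ-trans (-ᴹ‿cong β≈-α) (-ᴹ-involutive _))) (α-pos s)

  rest : Side → Fin rank → W.Carrier → W.Carrier
  rest inside  q ρ = ρ
  rest outside q ρ = simple q ∙ ρ

  facet-tail : ∀ {m} q (Q : Word m) {ρ} b I → IsFacet (q ∷ Q) ρ (b ∷ I) → IsFacet Q (rest b q ρ) I
  facet-tail q Q inside  I I-facet = I-facet
  facet-tail q Q outside I I-facet = ReducedExpression-tail q (facetWord Q I) I-facet

  -- When `b` is `outside`, the facet `b ∷ I` witnesses that some reduced expression of ρ begins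
  -- with q, so that prefixing q to J stays reduced.
  facet-cons : ∀ {m} q (Q : Word m) {ρ} b I J → IsFacet (q ∷ Q) ρ (b ∷ I) →
               IsFacet Q (rest b q ρ) J → IsFacet (q ∷ Q) ρ (b ∷ J)
  facet-cons q Q inside  I J I-facet J-facet = J-facet
  facet-cons q Q outside I J I-facet J-facet = 
    ReducedExpression-cons q (facetWord Q I) (facetWord Q J) I-facet J-facet

  -- If the root were -α_q, then `Neg⇒cancelling` would give a letter of I with root α_q. The
  -- leading q makes that root negative, which a reduced expression forbids.
  facet-root≉-α : ∀ {m} q (Q : Word m) I {ρ} k → IsFacet (q ∷ Q) ρ (outside ∷ I) →
                  ¬ (root Q I k ≈ᴹ -ᴹ α q)
  facet-root≉-α q Q I k qI-facet r≈-α with Neg⇒cancelling Q I k (≈-α⇒Neg q r≈-α)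
  ... | j , _ , j∉I , rⱼ≈-r = -α-not-Pos q
    (reflect-α-≈α q (≈ᴹ-trans rⱼ≈-r (≈ᴹ-trans (-ᴹ‿cong r≈-α) (-ᴹ-involutive _))))
    (facet-Pos (q ∷ Q) (outside ∷ I) qI-facet (there j∉I))

  reflect-α-injective : ∀ s {x y} → reflect (α s) x ≈ᴹ reflect (α s) y → x ≈ᴹ y
  reflect-α-injective s sx≈sy = ≈ᴹ-trans (≈ᴹ-sym (reflect-α-involutive s _))
    (≈ᴹ-trans (reflect-α-cong s sx≈sy) (reflect-α-involutive s _))

  -- Strip letters until j comes first. A later root equal to α_q would be -α_q before q is applied,
  -- contrary to `facet-root≉-α`.
  facet-root-≉ : ∀ {m} (Q : Word m) {ρ} I {j k} → IsFacet Q ρ I → I [ j ]= outside → j Fin.< k →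
                 ¬ (root Q I k ≈ᴹ root Q I j)
  facet-root-≉ (q ∷ Q) (outside ∷ I) {k = suc k} I-facet here j<k qr≈α =
    facet-root≉-α q Q I k I-facet (reflect-α-injective q
      (≈ᴹ-trans qr≈α (≈ᴹ-sym (reflect-α-≈-α q ≈ᴹ-refl))))
  facet-root-≉ (q ∷ Q) (inside ∷ I) {k = suc k} I-facet (there j∉I) j<k =
    facet-root-≉ Q I I-facet j∉I (s<s⁻¹ j<k)
  facet-root-≉ (q ∷ Q) (outside ∷ I) {k = suc k} I-facet (there j∉I) j<k =
    facet-root-≉ Q I (facet-tail q Q outside I I-facet) j∉I (s<s⁻¹ j<k) ∘ reflect-α-injective q

  -- Facets with positive roots and their uniqueness

  Positive : ∀ {m} → Word m → Pred (Subset m) _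
  Positive Q I = ∀ k → k ∈ I → Pos (root Q I k)

  Positive-inside : ∀ {m q} {Q : Word m} {I} → Positive Q I → Positive (q ∷ Q) (inside ∷ I)
  Positive-inside {q = q} I-positive zero    _           = α-pos q
  Positive-inside         I-positive (suc k) (there k∈I) = I-positive k k∈I

  -- A negative root that q makes positive is -α_q, which `facet-root≉-α` excludes.
  Positive-tail : ∀ {m} q (Q : Word m) {ρ} b I → IsFacet (q ∷ Q) ρ (b ∷ I) →
                  Positive (q ∷ Q) (b ∷ I) → Positive Q I
  Positive-tail q Q inside  I I-facet I-positive k k∈I = I-positive (suc k) (there k∈I)
  Positive-tail q Q outside I I-facet I-positive k k∈I with sign (root-∈Φ Q I k)
  ... | inj₁ r>0 = r>0
  ... | inj₂ r<0 = contradiction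
    (Neg-Pos-reflect⇒≈-α q (root-∈Φ Q I k) r<0 (I-positive (suc k) (there k∈I)))
    (facet-root≉-α q Q I k I-facet)

  -- Roots up to x do not change, and later ones are reflected in α_s. A later root that became
  -- negative would have been α_s, the root at the letter x, contrary to `facet-root-≉`.
  Positive-add : ∀ {m} (Q : Word m) I x {ρ s} → IsFacet Q ρ (I [ x ]≔ outside) → Positive Q (I [ x ]≔ outside) →
             root Q I x ≈ᴹ α s → Positive Q (I [ x ]≔ inside)
  Positive-add Q I x {s = s} I-facet I-positive rₓ≈α k k∈I with Finₚ.<-cmp k x
  ... | tri< _ k≢x k≯x = ≡.subst Pos
    (≡.trans (root-≤ Q I x outside k k≯x) (≡.sym (root-≤ Q I x inside k k≯x)))
    (I-positive k ([]=-change I x k≢x k∈I))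
  ... | tri≈ _ ≡.refl x≮x =
    Pos-cong (≈ᴹ-sym (≈ᴹ-trans (≈ᴹ-reflexive (root-≤ Q I x inside x x≮x)) rₓ≈α)) (α-pos s)
  ... | tri> k≮x k≢x x<k with sign (root-∈Φ Q (I [ x ]≔ inside) k)
  ...   | inj₁ r>0 = r>0
  ...   | inj₂ r<0 = contradiction rₖ≈rₓ
          (facet-root-≉ Q (I [ x ]≔ outside) I-facet (Vecₚ.[]≔-updates I x) x<k)
    where
    open ≈-Reasoning ≈ᴹ-setoid
    rₖ≈sr : root Q (I [ x ]≔ outside) k ≈ᴹ reflect (α s) (root Q (I [ x ]≔ inside) k)
    rₖ≈sr = ≈ᴹ-trans (root-> Q I x k x<k) (reflect-cong rₓ≈α ≈ᴹ-refl)
    rₖ≈rₓ : root Q (I [ x ]≔ outside) k ≈ᴹ root Q (I [ x ]≔ outside) x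
    rₖ≈rₓ = begin
      root Q (I [ x ]≔ outside) k                  ≈⟨ rₖ≈sr ⟩
      reflect (α s) (root Q (I [ x ]≔ inside) k)   ≈⟨ reflect-α-≈-α s
                                                      (Neg-Pos-reflect⇒≈-α s (root-∈Φ Q _ k) r<0
                                                        (Pos-cong rₖ≈sr (I-positive k ([]=-change I x k≢x k∈I)))) ⟩
      α s                                          ≈⟨ rₓ≈α ⟨
      root Q I x                                   ≡⟨ root-≤ Q I x outside x (Finₚ.<-irrefl ≡.refl) ⟨
      root Q (I [ x ]≔ outside) x                  ∎

  -- Trades the leading q for the letter at x: letting that letter into the word multiplies by q on
  -- the left, so the product and the length stay the same.
  facet-remove : ∀ {m} q (Q : Word m) I x {ρ} → IsFacet (q ∷ Q) ρ (outside ∷ I) → x ∈ I →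
                 root Q I x ≈ᴹ α q → IsFacet Q ρ (I [ x ]≔ outside)
  facet-remove q Q I x {ρ} qI-facet x∈I r≈α =
    ReducedExpression-≤ (q ∷ facetWord Q I) (facetWord Q (I [ x ]≔ outside)) qI-facet
      (W.trans (product-facetWord Q I x r≈α)
        (≡.subst (λ J → simple q ∙ product (facetWord Q J) ≈ʷ ρ) (≡.sym ([]=⇒[]≔ I x∈I))
          (proj₁ qI-facet)))
      (ℕₚ.≤-reflexive (≡.trans (length-facetWord Q I x)
        (≡.cong (ℕ.suc ∘ length ∘ facetWord Q) ([]=⇒[]≔ I x∈I))))

  -- Dropping the letter at x multiplies by q on the left and saves one letter.
  facet-add : ∀ {m} q (Q : Word m) I x {ρ} → IsFacet Q ρ (I [ x ]≔ outside) →
              root Q I x ≈ᴹ α q → IsFacet Q (simple q ∙ ρ) (I [ x ]≔ inside)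
  facet-add q Q I x {ρ} I-facet r≈α =
    ReducedExpression-descent q (facetWord Q (I [ x ]≔ outside)) (facetWord Q (I [ x ]≔ inside)) I-facet
      (W.trans (W.sym (simple-involutive q _))
        (W.∙-congˡ (W.trans (W.sym (product-facetWord Q I x r≈α)) (proj₁ I-facet))))
      (length-facetWord Q I x)

  -- Take x to be the last position of I at which the root of outside ∷ I is
  -- negative, i.e. at which root Q I x ≈ α q.
  Positive-outside⊎Positive-remove : ∀ {m} q (Q : Word m) I → Positive Q I →
    (∃[ x ] x ∈ I × root Q I x ≈ᴹ α q × Positive Q (I [ x ]≔ outside)) ⊎ Positive (q ∷ Q) (outside ∷ I)
  Positive-outside⊎Positive-remove q Q I I-positive with last-or-all split
    where
    split : ∀ k → (k ∈ I × root Q I k ≈ᴹ α q) ⊎ (k ∈ I → Pos (reflect (α q) (root Q I k)))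
    split k with lookup I k in Iₖ≡b | sign (reflect-∈Φ q (root-∈Φ Q I k))
    ... | _       | inj₁ qr>0 = inj₂ λ _ → qr>0
    ... | outside | inj₂ qr<0 = inj₂ λ k∈I →
      contradiction (≡.trans (≡.sym Iₖ≡b) (Vecₚ.[]=⇒lookup k∈I)) λ ()
    ... | inside  | inj₂ qr<0 =
      inj₁ (k∈I , Pos-Neg-reflect⇒≈α q (root-∈Φ Q I k) (I-positive k k∈I) qr<0)
      where
      k∈I : k ∈ I
      k∈I = Vecₚ.lookup⇒[]= k I Iₖ≡b
  ... | inj₂ all = inj₂ λ { (suc k) (there k∈I) → all k k∈I }
  ... | inj₁ (x , (x∈I , rₓ≈α) , all) = inj₁ (x , x∈I , rₓ≈α , positive)
    where
    I′≡I : I [ x ]≔ inside ≡ I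
    I′≡I = []=⇒[]≔ I x∈I
    positive : Positive Q (I [ x ]≔ outside)
    positive k k∈I[x] with Finₚ.<-cmp k x | ∈[]≔outside⇒≢ I x k∈I[x]
    ... | tri≈ _ k≡x _   | k≢x = contradiction k≡x k≢x
    ... | tri< _ _   k≯x | k≢x = ≡.subst Pos (≡.sym (root-≤ Q I x outside k k≯x))
      (I-positive k (≡.subst (k ∈_) I′≡I ([]=-change I x k≢x k∈I[x])))
    -- Beyond x, the letter now read at x acts on the roots as a leading q would, and no root there
    -- turns negative under q because x is last.
    ... | tri> _ _   x<k | k≢x = Pos-cong (≈ᴹ-sym (begin
        root Q (I [ x ]≔ outside) k                        ≈⟨ root-> Q I x k x<k ⟩
        reflect (root Q I x) (root Q (I [ x ]≔ inside) k)
          ≈⟨ reflect-cong rₓ≈α (≈ᴹ-reflexive (≡.cong (λ J → root Q J k) I′≡I)) ⟩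
        reflect (α q) (root Q I k)                         ∎))
      (all k x<k (≡.subst (k ∈_) I′≡I ([]=-change I x k≢x k∈I[x])))
      where open ≈-Reasoning ≈ᴹ-setoid

  -- Some letter j turns the moving image of γ from negative to positive. There the image becomes
  -- the simple root of j, and the letters to the left carry it both to the root at j and to the
  -- final image.
  sign-change : ∀ {m} (Q : Word m) I {γ} → γ ∈ᴹ Φ → Neg γ → Pos (act (facetWord Q I) γ) →
                ∃[ j ] I [ j ]= outside × root Q I j ≈ᴹ act (facetWord Q I) γ
  sign-change []      []            γ∈Φ γ<0 γ>0 = ⊥-elim (Pos-Neg-contradiction γ∈Φ γ>0 γ<0)
  sign-change (q ∷ Q) (inside ∷ I)  γ∈Φ γ<0 wγ>0 with sign-change Q I γ∈Φ γ<0 wγ>0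
  ... | j , j∉I , rⱼ≈wγ = suc j , there j∉I , rⱼ≈wγ
  sign-change (q ∷ Q) (outside ∷ I) γ∈Φ γ<0 qwγ>0 with sign (act-∈Φ (facetWord Q I) γ∈Φ)
  ... | inj₂ wγ<0 = zero , here , ≈ᴹ-sym (reflect-α-≈-α q
                      (Neg-Pos-reflect⇒≈-α q (act-∈Φ (facetWord Q I) γ∈Φ) wγ<0 qwγ>0))
  ... | inj₁ wγ>0 with sign-change Q I γ∈Φ γ<0 wγ>0
  ...   | j , j∉I , rⱼ≈wγ = suc j , there j∉I , reflect-α-cong q rⱼ≈wγ

  act-neg-α : ∀ q u v {γ} → product (q ∷ v) ≈ʷ product u → act u γ ≈ᴹ α q → act v (-ᴹ γ) ≈ᴹ α q
  act-neg-α q u v {γ} qv≈u uγ≈α = begin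
    act v (-ᴹ γ)                               ≈⟨ act-neg v γ ⟩
    -ᴹ act v γ                                 ≈⟨ -ᴹ‿cong (reflect-α-involutive q _) ⟨
    -ᴹ reflect (α q) (reflect (α q) (act v γ))
      ≈⟨ -ᴹ‿cong (reflect-α-cong q (product-≈⇒act-≈ (q ∷ v) u qv≈u γ)) ⟩
    -ᴹ reflect (α q) (act u γ)                 ≈⟨ -ᴹ‿cong (reflect-α-≈α q uγ≈α) ⟩
    -ᴹ (-ᴹ α q)                                ≈⟨ -ᴹ-involutive _ ⟩
    α q                                        ∎
    where open ≈-Reasoning ≈ᴹ-setoid

  -- Since a reduced expression of ρ begins with q, ρ⁻¹ sends α_q to a negative root. Following that
  -- root through the word of I back to α_q meets a change of sign.
  facets⇒addable : ∀ {m} q (Q : Word m) I J {ρ} → IsFacet Q ρ I → IsFacet (q ∷ Q) ρ (outside ∷ J) →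
                   ∃[ j ] I [ j ]= outside × root Q I j ≈ᴹ α q
  facets⇒addable q Q I J (I≈ρ , _) qJ-facet@(qJ≈ρ , _)
    with act-surjective (facetWord Q I) (isRoot q)
  ... | γ , γ∈Φ , Iγ≈α with sign γ∈Φ
  ...   | inj₂ γ<0 with sign-change Q I γ∈Φ γ<0 (Pos-cong (≈ᴹ-sym Iγ≈α) (α-pos q))
  ...     | j , j∉I , rⱼ≈ = j , j∉I , ≈ᴹ-trans rⱼ≈ Iγ≈α
  -- If γ were positive, the word of J would carry the negative root -γ to α_q. A letter of J would
  -- then have root α_q, which the leading q makes negative.
  facets⇒addable q Q I J (I≈ρ , _) qJ-facet@(qJ≈ρ , _) | γ , γ∈Φ , Iγ≈α | inj₁ γ>0
    with J-γ≈α ← act-neg-α q (facetWord Q I) (facetWord Q J) (W.trans qJ≈ρ (W.sym I≈ρ)) Iγ≈α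
    with sign-change Q J (neg-∈Φ γ∈Φ) (Pos⇒Neg- γ>0) (Pos-cong (≈ᴹ-sym J-γ≈α) (α-pos q))
  ... | j , j∉J , rⱼ≈ = ⊥-elim (-α-not-Pos q (reflect-α-≈α q (≈ᴹ-trans rⱼ≈ J-γ≈α))
                           (facet-Pos (q ∷ Q) (outside ∷ J) qJ-facet (there j∉J)))

  Positive-unique : ∀ {m} (Q : Word m) I J {ρ} → IsFacet Q ρ I → IsFacet Q ρ J →
                Positive Q I → Positive Q J → I ≡ J
  -- Adding to I a position j with root α_q gives a positive facet for the same element as J, hence
  -- J itself by uniqueness on the shorter word. The leading q then makes the root at j negative.
  Positive-inside-outside : ∀ {m} q (Q : Word m) I J {ρ} →
                        IsFacet (q ∷ Q) ρ (inside ∷ I) → IsFacet (q ∷ Q) ρ (outside ∷ J) →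
                        Positive (q ∷ Q) (inside ∷ I) → Positive (q ∷ Q) (outside ∷ J) → ⊥

  Positive-unique []      []            []            _ _ _ _ = ≡.refl
  Positive-unique (q ∷ Q) (inside ∷ I)  (inside ∷ J)  I-facet J-facet I-positive J-positive =
    ≡.cong (inside ∷_) (Positive-unique Q I J I-facet J-facet
      (Positive-tail q Q inside I I-facet I-positive) (Positive-tail q Q inside J J-facet J-positive))
  Positive-unique (q ∷ Q) (outside ∷ I) (outside ∷ J) I-facet J-facet I-positive J-positive =
    ≡.cong (outside ∷_) (Positive-unique Q I J
      (facet-tail q Q outside I I-facet) (facet-tail q Q outside J J-facet)
      (Positive-tail q Q outside I I-facet I-positive) (Positive-tail q Q outside J J-facet J-positive))
  Positive-unique (q ∷ Q) (inside ∷ I)  (outside ∷ J) I-facet J-facet I-positive J-positive =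
    ⊥-elim (Positive-inside-outside q Q I J I-facet J-facet I-positive J-positive)
  Positive-unique (q ∷ Q) (outside ∷ I) (inside ∷ J)  I-facet J-facet I-positive J-positive =
    ⊥-elim (Positive-inside-outside q Q J I J-facet I-facet J-positive I-positive)

  Positive-inside-outside q Q I J {ρ} I-facet qJ-facet qI-positive qJ-positive
    with facets⇒addable q Q I J I-facet qJ-facet
  ... | j , j∉I , rⱼ≈α = -α-not-Pos q (reflect-α-≈α q root-J≈α) (qJ-positive (suc j) (there j∈J))
    where
    open ≈-Reasoning ≈ᴹ-setoid
    I-positive : Positive Q I
    I-positive = Positive-tail q Q inside I I-facet qI-positive
    I′≡I : I [ j ]≔ outside ≡ I
    I′≡I = []=⇒[]≔ I j∉I
    I′-facet : IsFacet Q ρ (I [ j ]≔ outside)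
    I′-facet = ≡.subst (IsFacet Q ρ) (≡.sym I′≡I) I-facet
    I+j≡J : I [ j ]≔ inside ≡ J
    I+j≡J = Positive-unique Q (I [ j ]≔ inside) J
      (facet-add q Q I j I′-facet rⱼ≈α) (facet-tail q Q outside J qJ-facet)
      (Positive-add Q I j I′-facet (≡.subst (Positive Q) (≡.sym I′≡I) I-positive) rⱼ≈α)
      (Positive-tail q Q outside J qJ-facet qJ-positive)
    j∈J : j ∈ J
    j∈J = ≡.subst (j ∈_) I+j≡J (Vecₚ.[]≔-updates I j)
    root-J≈α : root Q J j ≈ᴹ α q
    root-J≈α = begin
      root Q J j                 ≡⟨ ≡.cong (λ J → root Q J j) I+j≡J ⟨
      root Q (I [ j ]≔ inside) j ≡⟨ root-≤ Q I j inside j (Finₚ.<-irrefl ≡.refl) ⟩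
      root Q I j                 ≈⟨ rⱼ≈α ⟩
      α q                        ∎

  -- Increasing flips by recursion along the word

  -- An increasing exchange in a form that allows recursion along the word.
  data Raises : ∀ {m} → Subset m → Fin m → Subset m → Fin m → Set where
    here  : ∀ {m} (I : Subset m) x →
            Raises (inside ∷ I [ x ]≔ outside) zero (outside ∷ I [ x ]≔ inside) (suc x)
    there : ∀ {m} b {I J : Subset m} {i j} → Raises I i J j → Raises (b ∷ I) (suc i) (b ∷ J) (suc j)

  remove≡[]≔ : ∀ {m} (I : Subset m) x → I - x ≡ I [ x ]≔ outside
  remove≡[]≔ (b ∷ I) zero    = ≡.cong (outside ∷_) (Subsetₚ.p─⊥≡p I)
  remove≡[]≔ (b ∷ I) (suc x) = ≡.cong (b ∷_) (remove≡[]≔ I x)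

  exchange⇒raises : ∀ {m} {I J : Subset m} {i j} → Exchange I i J j → i Fin.< j → Raises I i J j
  exchange⇒raises e = go (Exchange.i∈I e) (Exchange.j∈J e) (Exchange.same e)
    where
    go : ∀ {m} {I J : Subset m} {i j} → i ∈ I → j ∈ J → I - i ≡ J - j → i Fin.< j → Raises I i J j
    go {I = inside ∷ I} {b ∷ J} {zero} {suc j} here (there j∈J) I-i≡J-j i<j
      -- Removing the first position from I leaves `outside`, so the heads force `b` to be `outside`
      -- and the tails differ only at j.
      with ≡.refl , I≡J-j ← Vecₚ.∷-injective I-i≡J-j =
      ≡.subst₂ (λ I J → Raises (inside ∷ I) zero (outside ∷ J) (suc j))
        (≡.sym (≡.trans (≡.sym (Subsetₚ.p─⊥≡p I)) (≡.trans I≡J-j (remove≡[]≔ J j))))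
        ([]=⇒[]≔ J j∈J) (here J j)
    go {I = b ∷ I} {b′ ∷ J} {suc i} {suc j} (there i∈I) (there j∈J) I-i≡J-j i<j
      with ≡.refl , I-i≡J-j′ ← Vecₚ.∷-injective I-i≡J-j =
      there b (go i∈I j∈J I-i≡J-j′ (s<s⁻¹ i<j))

  raises⇒< : ∀ {m} {I J : Subset m} {i j} → Raises I i J j → i Fin.< j
  raises⇒< (here I x)  = z<s
  raises⇒< (there b r) = s<s (raises⇒< r)

  raises⇒exchange : ∀ {m} {I J : Subset m} {i j} → Raises I i J j → Exchange I i J j
  raises⇒exchange (here I x) = record
    { distinct = λ ()
    ; i∈I      = here
    ; j∈J      = there (Vecₚ.[]≔-updates I x)
    ; same     = ≡.cong (outside ∷_) (begin
        I [ x ]≔ outside ─ Subset.⊥            ≡⟨ Subsetₚ.p─⊥≡p _ ⟩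
        I [ x ]≔ outside                       ≡⟨ Vecₚ.[]≔-idempotent I x ⟨
        I [ x ]≔ inside [ x ]≔ outside         ≡⟨ remove≡[]≔ (I [ x ]≔ inside) x ⟨
        I [ x ]≔ inside - x                    ∎)
    }
    where open ≡ₚ.≡-Reasoning
  raises⇒exchange (there b r) = record
    { distinct = λ bI≡bJ → Exchange.distinct e (Vecₚ.∷-injectiveʳ bI≡bJ)
    ; i∈I      = there (Exchange.i∈I e)
    ; j∈J      = there (Exchange.j∈J e)
    ; same     = ≡.cong (b ∷_) (Exchange.same e)
    }
    where e = raises⇒exchange r

  raises⇒flip : ∀ {m} {Q : Word m} {ρ I J i j} → Raises I i J j → IsFacet Q ρ I → IsFacet Q ρ J →
                IncreasingFlip Q ρ I J
  raises⇒flip r I-facet J-facet = record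
    { facetˡ = I-facet ; facetʳ = J-facet ; exchange = raises⇒exchange r ; increasing = raises⇒< r }

  flip⇒raises : ∀ {m} {Q : Word m} {ρ I J} (e : IncreasingFlip Q ρ I J) →
                Raises I (IncreasingFlip.out e) J (IncreasingFlip.into e)
  flip⇒raises e = exchange⇒raises (IncreasingFlip.exchange e) (IncreasingFlip.increasing e)

  -- Let r be the root at x. Both words express ρ, so the reflections in r and in α_q agree after u;
  -- at a preimage of r this gives -r = q r. As the root at a letter of a facet, r is positive, and
  -- q makes it negative.
  raise-root : ∀ {m} q (Q : Word m) I x {ρ} → IsFacet Q ρ (I [ x ]≔ outside) →
               IsFacet (q ∷ Q) ρ (outside ∷ I [ x ]≔ inside) → root Q I x ≈ᴹ α q
  raise-root q Q I x I-facet@(I≈ρ , _) qI-facet@(qI≈ρ , _)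
    with act-surjective (facetWord Q (I [ x ]≔ inside)) (root-∈Φ Q I x)
  ... | γ , γ∈Φ , uγ≈r = Pos-Neg-reflect⇒≈α q (root-∈Φ Q I x)
    r>0
    (Pos-cong (≈ᴹ-trans (≈ᴹ-sym (-ᴹ-involutive _)) (-ᴹ‿cong -r≈qr)) r>0)
    where
    open ≈-Reasoning ≈ᴹ-setoid
    u = facetWord Q (I [ x ]≔ inside)
    u′ = facetWord Q (I [ x ]≔ outside)
    r = root Q I x
    r>0 : Pos r
    r>0 = ≡.subst Pos (root-≤ Q I x outside x (Finₚ.<-irrefl ≡.refl))
            (facet-Pos Q (I [ x ]≔ outside) I-facet (Vecₚ.[]≔-updates I x))
    -r≈qr : -ᴹ r ≈ᴹ reflect (α q) r
    -r≈qr = begin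
      -ᴹ r                       ≈⟨ reflect-self (IsRootSystem.nonzero isRootSystem (root-∈Φ Q I x)) ⟨
      reflect r r                ≈⟨ reflect-cong ≈ᴹ-refl uγ≈r ⟨
      reflect r (act u γ)        ≈⟨ act-facetWord Q I x γ ⟨
      act u′ γ                   ≈⟨ product-≈⇒act-≈ u′ (q ∷ u) (W.trans I≈ρ (W.sym qI≈ρ)) γ ⟩
      reflect (α q) (act u γ)    ≈⟨ reflect-α-cong q uγ≈r ⟩
      reflect (α q) r            ∎

  raise-root′ : ∀ {m} q (Q : Word m) I x {ρ} → IsFacet Q ρ (I [ x ]≔ outside) →
                IsFacet (q ∷ Q) ρ (outside ∷ I [ x ]≔ inside) → root Q (I [ x ]≔ inside) x ≈ᴹ α q
  raise-root′ q Q I x I-facet qI-facet =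
    ≈ᴹ-trans (≈ᴹ-reflexive (root-≤ Q I x inside x (Finₚ.<-irrefl ≡.refl)))
      (raise-root q Q I x I-facet qI-facet)

  -- In the suffix from i on, the position flipped in has root -α_q, while positivity would pass to
  -- that suffix.
  raises⇒¬Positive : ∀ {m} (Q : Word m) {ρ I J i j} → Raises I i J j → IsFacet Q ρ I → IsFacet Q ρ J →
                     ¬ Positive Q J
  raises⇒¬Positive (q ∷ Q) (here I x) I-facet J-facet J-positive =
    -α-not-Pos q (reflect-α-≈α q (raise-root′ q Q I x I-facet J-facet))
      (J-positive (suc x) (there (Vecₚ.[]≔-updates I x)))
  raises⇒¬Positive (q ∷ Q) (there b {I} {J} r) I-facet J-facet J-positive =
    raises⇒¬Positive Q r (facet-tail q Q b I I-facet) (facet-tail q Q b J J-facet) (Positive-tail q Q b J J-facet J-positive)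

  Positive⇒source : ∀ {m} (Q : Word m) {ρ P} → IsFacet Q ρ P → Positive Q P → IsSource Q ρ P
  Positive⇒source Q P-facet P-positive = P-facet , λ I e →
    raises⇒¬Positive Q (flip⇒raises e) (IncreasingFlip.facetˡ e) P-facet P-positive

  -- Rising paths from positive facets

  flip-cons : ∀ {m} q (Q : Word m) {ρ} b I₀ {I J} → IsFacet (q ∷ Q) ρ (b ∷ I₀) →
              IncreasingFlip Q (rest b q ρ) I J → IncreasingFlip (q ∷ Q) ρ (b ∷ I) (b ∷ J)
  flip-cons q Q b I₀ {I} {J} I₀-facet e = raises⇒flip (there b (flip⇒raises e))
    (facet-cons q Q b I₀ I I₀-facet (IncreasingFlip.facetˡ e))
    (facet-cons q Q b I₀ J I₀-facet (IncreasingFlip.facetʳ e))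

  path-cons : ∀ {m} q (Q : Word m) {ρ} b I₀ {I J} → IsFacet (q ∷ Q) ρ (b ∷ I₀) →
              Path Q (rest b q ρ) I J → Path (q ∷ Q) ρ (b ∷ I) (b ∷ J)
  path-cons q Q b I₀ I₀-facet = Star.gmap (b ∷_) (flip-cons q Q b I₀ I₀-facet)

  pLabels-path-cons : ∀ {m} q (Q : Word m) {ρ} b I₀ {I J} (I₀-facet : IsFacet (q ∷ Q) ρ (b ∷ I₀))
                      (π : Path Q (rest b q ρ) I J) →
                      pLabels (path-cons q Q b I₀ I₀-facet π) ≡ List.map suc (pLabels π)
  pLabels-path-cons q Q b I₀ I₀-facet nil     = ≡.refl
  pLabels-path-cons q Q b I₀ I₀-facet (e ◅ π) =
    ≡.cong (suc (IncreasingFlip.out e) ∷_) (pLabels-path-cons q Q b I₀ I₀-facet π)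

  rising-cons : ∀ {m} q (Q : Word m) {ρ} b I₀ {I J} (I₀-facet : IsFacet (q ∷ Q) ρ (b ∷ I₀))
                (π : Path Q (rest b q ρ) I J) → Rising π → Rising (path-cons q Q b I₀ I₀-facet π)
  rising-cons q Q b I₀ I₀-facet π π-rising =
    ≡.subst (Linked Fin._<_) (≡.sym (pLabels-path-cons q Q b I₀ I₀-facet π))
      (Linkedₚ.map⁺ (Linked.map s<s π-rising))

  rising-zero∷ : ∀ {m} {ks : List (Fin m)} → Linked Fin._<_ (List.map suc ks) →
                 Linked Fin._<_ (zero ∷ List.map suc ks)
  rising-zero∷ {ks = []}     _  = Linked.[-]
  rising-zero∷ {ks = k ∷ ks} ks-rising = z<s Linked.∷ ks-rising

  greedyPath : ∀ {m} (Q : Word m) I {ρ} → IsFacet Q ρ I →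
               ∃[ P ] IsFacet Q ρ P × Positive Q P × Σ[ π ∈ Path Q ρ P I ] Rising π
  greedyPath [] [] I-facet = [] , I-facet , (λ ()) , nil , Linked.[]
  greedyPath (q ∷ Q) (b ∷ I) I-facet with greedyPath Q I (facet-tail q Q b I I-facet)
  greedyPath (q ∷ Q) (inside ∷ I) I-facet | P , P-facet , P-positive , π , π-rising =
    inside ∷ P , P-facet , Positive-inside P-positive ,
    path-cons q Q inside I I-facet π , rising-cons q Q inside I I-facet π π-rising
  greedyPath (q ∷ Q) (outside ∷ I) {ρ} I-facet | P , P-facet , P-positive , π , π-rising
    with Positive-outside⊎Positive-remove q Q P P-positive
  ... | inj₂ qP-positive =
    outside ∷ P , facet-cons q Q outside I P I-facet P-facet , qP-positive ,
    path-cons q Q outside I I-facet π , rising-cons q Q outside I I-facet π π-rising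
  ... | inj₁ (x , x∈P , rₓ≈α , P-x-positive) =
    inside ∷ P [ x ]≔ outside , P-x-facet , Positive-inside P-x-positive , e ◅ π′ ,
    -- The new edge has label `zero` and all labels of the lifted path are successors, so the path
    -- stays rising.
    ≡.subst (λ ks → Linked Fin._<_ (zero ∷ ks)) (≡.sym (pLabels-path-cons q Q outside I I-facet π))
      (rising-zero∷ (≡.subst (Linked Fin._<_) (pLabels-path-cons q Q outside I I-facet π)
        (rising-cons q Q outside I I-facet π π-rising)))
    where
    qP-facet : IsFacet (q ∷ Q) ρ (outside ∷ P)
    qP-facet = facet-cons q Q outside I P I-facet P-facet
    P-x-facet : IsFacet Q ρ (P [ x ]≔ outside)
    P-x-facet = facet-remove q Q P x qP-facet x∈P rₓ≈α
    π′ : Path (q ∷ Q) ρ (outside ∷ P) (outside ∷ I)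
    π′ = path-cons q Q outside I I-facet π
    e : IncreasingFlip (q ∷ Q) ρ (inside ∷ P [ x ]≔ outside) (outside ∷ P)
    e = raises⇒flip
          (≡.subst (λ J → Raises (inside ∷ P [ x ]≔ outside) zero (outside ∷ J) (suc x))
            ([]=⇒[]≔ P x∈P) (here P x))
          P-x-facet qP-facet

  -- Paths grow at the front, whereas the father is found at the last edge.
  data SnocView {m} {Q : Word m} {ρ I} : ∀ {J} → Path Q ρ I J → Set ℓw where
    []   : SnocView nil
    _∷ʳ_ : ∀ {F J} (π : Path Q ρ I F) (e : IncreasingFlip Q ρ F J) → SnocView (π ◅◅ (e ◅ nil))

  snocView : ∀ {m} {Q : Word m} {ρ I J} (π : Path Q ρ I J) → SnocView π
  snocView nil     = []
  snocView (e ◅ π) with snocView π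
  ... | []      = nil ∷ʳ e
  ... | π ∷ʳ e′ = (e ◅ π) ∷ʳ e′

  -- Another source is reached by a path from some positive facet. No edge enters a source, so the
  -- path is empty, the source is positive, and `Positive-unique` applies.
  Positive⇒greedy : ∀ {m} (Q : Word m) {ρ P} → IsFacet Q ρ P → Positive Q P → IsPositiveGreedy Q ρ P
  Positive⇒greedy Q {ρ} {P} P-facet P-positive = Positive⇒source Q P-facet P-positive , unique
    where
    unique : ∀ P′ → IsSource Q ρ P′ → P′ ≡ P
    unique P′ (P′-facet , P′-source) with greedyPath Q P′ P′-facet
    ... | P″ , P″-facet , P″-positive , π , _ with snocView π
    ...   | []     = Positive-unique Q P′ P P′-facet P-facet P″-positive P-positive
    ...   | _ ∷ʳ e = contradiction e (P′-source _)

  -- Root functions and suffixes in recursive form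

  rootFunction≈root : ∀ {m} (Q : Word m) I k → rootFunction 𝒜 Q I k ≈ᴹ root Q I k
  rootFunction≈root (q ∷ Q) (b ∷ I) zero =
    ≈ᴹ-trans (≈ᴹ-reflexive (≡.cong (λ u → product u ▷ α q) (prefix-zero (q ∷ Q) (b ∷ I)))) (▷-identity _)
    where
    prefix-zero : ∀ {m} (Q : Word m) I → subword Q (tabulate (λ _ → outside) ─ I) ≡ []
    prefix-zero []      []            = ≡.refl
    prefix-zero (q ∷ Q) (inside ∷ I)  = prefix-zero Q I
    prefix-zero (q ∷ Q) (outside ∷ I) = prefix-zero Q I
  rootFunction≈root (q ∷ Q) (inside ∷ I)  (suc k) = rootFunction≈root Q I k
  rootFunction≈root (q ∷ Q) (outside ∷ I) (suc k) =
    ≈ᴹ-trans (▷-assoc _ _ _) (≈ᴹ-trans (▷-simple q _) (reflect-α-cong q (rootFunction≈root Q I k)))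

  subword-from : ∀ {m} (Q : Word m) I y → subword Q (from y ─ I) ≡ facetWord (suffix y Q) (suffix y I)
  subword-from (q ∷ Q) (b ∷ I) zero = from-zero (q ∷ Q) (b ∷ I)
    where
    from-zero : ∀ {m} (Q : Word m) I → subword Q (∁ (tabulate (λ _ → outside)) ─ I) ≡ facetWord Q I
    from-zero []      []            = ≡.refl
    from-zero (q ∷ Q) (inside ∷ I)  = from-zero Q I
    from-zero (q ∷ Q) (outside ∷ I) = ≡.cong (q ∷_) (from-zero Q I)
  subword-from (q ∷ Q) (inside ∷ I)  (suc y) = subword-from Q I y
  subword-from (q ∷ Q) (outside ∷ I) (suc y) = subword-from Q I y

  facet⇒≈ : ∀ {m} (Q : Word m) I {ρ ρ′} → IsFacet Q ρ I → product (facetWord Q I) ≈ʷ ρ′ → IsFacet Q ρ′ I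
  facet⇒≈ Q I I-facet I≈ρ′ =
    ReducedExpression-cong (facetWord Q I) (W.trans (W.sym (proj₁ I-facet)) I≈ρ′) I-facet

  suffix-facet : ∀ {m} (Q : Word m) I {ρ} y → IsFacet Q ρ I →
                 IsFacet (suffix y Q) (Π Q (from y ─ I)) (suffix y I)
  suffix-facet Q@(_ ∷ _) I@(_ ∷ _) zero I-facet =
    facet⇒≈ Q I I-facet (W.reflexive (≡.cong product (≡.sym (subword-from Q I zero))))
  suffix-facet (q ∷ Q) (inside ∷ I)  (suc y) I-facet = suffix-facet Q I y I-facet
  suffix-facet (q ∷ Q) (outside ∷ I) (suc y) I-facet =
    suffix-facet Q I y (facet-tail q Q outside I I-facet)

  -- Recovering the last flip from the facet it reaches

  Positive-suffix : ∀ {m} (Q : Word m) I {ρ} y → IsFacet Q ρ I → Positive Q I → Positive (suffix y Q) (suffix y I)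
  Positive-suffix Q       I       zero    I-facet I-positive = I-positive
  Positive-suffix (q ∷ Q) (b ∷ I) (suc y) I-facet I-positive =
    Positive-suffix Q I y (facet-tail q Q b I I-facet) (Positive-tail q Q b I I-facet I-positive)

  -- On the word after i, the flip adds a position whose root is α_q, so `Positive-add` applies;
  -- later suffixes inherit positivity.
  raises⇒Positive-suffix : ∀ {m} (Q : Word m) {ρ I J i j} → Raises I i J j → IsFacet Q ρ I → IsFacet Q ρ J →
                       Positive (suffix i Q) (suffix i I) → ∀ k → i Fin.< k → Positive (suffix k Q) (suffix k J)
  raises⇒Positive-suffix (q ∷ Q) (here I x) I-facet J-facet I-positive (suc k) _ =
    Positive-suffix Q (I [ x ]≔ inside) k (facet-tail q Q outside (I [ x ]≔ inside) J-facet)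
      (Positive-add Q I x I-facet (Positive-tail q Q inside (I [ x ]≔ outside) I-facet I-positive)
        (raise-root q Q I x I-facet J-facet))
  raises⇒Positive-suffix (q ∷ Q) (there b {I} {J} r) I-facet J-facet I-positive (suc k) i<k =
    raises⇒Positive-suffix Q r (facet-tail q Q b I I-facet) (facet-tail q Q b J J-facet) I-positive k (s<s⁻¹ i<k)

  -- Restricted to the suffix from i on, the exchange is still an increasing flip, so the suffix of
  -- J is not a source.
  raises⇒suffixNotGreedy : ∀ {m} (Q : Word m) {ρ I J i j} → Raises I i J j → IsFacet Q ρ I → IsFacet Q ρ J →
                           SuffixNotGreedy Q J i
  raises⇒suffixNotGreedy (q ∷ Q) (here I x) I-facet J-facet ((J-facet′ , J-source) , _) =
    J-source (inside ∷ I [ x ]≔ outside) (raises⇒flip (here I x)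
      (facet⇒≈ (q ∷ Q) (inside ∷ I [ x ]≔ outside) I-facet
        (W.trans (proj₁ I-facet) (W.trans (W.sym (proj₁ J-facet)) (proj₁ J-facet′))))
      J-facet′)
  raises⇒suffixNotGreedy (q ∷ Q) (there inside r) I-facet J-facet = raises⇒suffixNotGreedy Q r I-facet J-facet
  raises⇒suffixNotGreedy (q ∷ Q) (there outside {I} {J} r) I-facet J-facet =
    raises⇒suffixNotGreedy Q r (facet-tail q Q outside I I-facet) (facet-tail q Q outside J J-facet)

  OppositeRoot : ∀ {m} → Word m → Subset m → Fin m → Pred (Fin m) _
  OppositeRoot Q I y k = k ∈ I × root Q I k ≈ᴹ -ᴹ root Q I y

  raises⇒largestOpposite : ∀ {m} (Q : Word m) {ρ I J i j} → Raises I i J j → IsFacet Q ρ I → IsFacet Q ρ J →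
                           Positive (suffix i Q) (suffix i I) → Largest (OppositeRoot Q J i) j
  raises⇒largestOpposite (q ∷ Q) (here I x) I-facet J-facet I-positive =
    (there (Vecₚ.[]≔-updates I x) , reflect-α-≈α q (raise-root′ q Q I x I-facet J-facet)) , largest
    where
    open ≈-Reasoning ≈ᴹ-setoid
    largest : ∀ k → OppositeRoot (q ∷ Q) (outside ∷ I [ x ]≔ inside) zero k → k Fin.≤ suc x
    largest zero    _                   = ℕ.z≤n
    largest (suc k) (there k∈I , qr≈-α) = ℕₚ.≮⇒≥ λ x<k →
      -- Beyond x the flip changes no root: the letter at x before it acts as the leading q after
      -- it. So the root at k was already -α_q.
      -α-not-Pos q (begin
        root Q (I [ x ]≔ outside) k
          ≈⟨ root-> Q I x k (s<s⁻¹ x<k) ⟩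
        reflect (root Q I x) (root Q (I [ x ]≔ inside) k)
          ≈⟨ reflect-cong (raise-root q Q I x I-facet J-facet) ≈ᴹ-refl ⟩
        reflect (α q) (root Q (I [ x ]≔ inside) k)
          ≈⟨ qr≈-α ⟩
        -ᴹ α q ∎)
        (I-positive (suc k) (there ([]=-change I x (λ k≡x → Finₚ.<⇒≢ (s<s⁻¹ x<k) (≡.sym k≡x)) k∈I)))
  raises⇒largestOpposite (q ∷ Q) (there b {I} {J} {i} {j} r) I-facet J-facet I-positive
    with (j∈J , rⱼ≈-rᵢ) , max ← raises⇒largestOpposite Q r (facet-tail q Q b I I-facet)
                                  (facet-tail q Q b J J-facet) I-positive =
    (there j∈J , opposite b rⱼ≈-rᵢ) , λ where
      zero    _                 → ℕ.z≤n
      (suc k) (there k∈J , opp) → ℕ.s≤s (max k (k∈J , opposite⁻¹ b opp))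
    where
    -- A common reflection is injective and commutes with negation, so opposite roots may be
    -- compared in the tail.
    opposite : ∀ b {k} → root Q J k ≈ᴹ -ᴹ root Q J i →
               root (q ∷ Q) (b ∷ J) (suc k) ≈ᴹ -ᴹ root (q ∷ Q) (b ∷ J) (suc i)
    opposite inside  opp = opp
    opposite outside opp = ≈ᴹ-trans (reflect-α-cong q opp) (reflect-neg _ _)
    opposite⁻¹ : ∀ b {k} → root (q ∷ Q) (b ∷ J) (suc k) ≈ᴹ -ᴹ root (q ∷ Q) (b ∷ J) (suc i) →
                 root Q J k ≈ᴹ -ᴹ root Q J i
    opposite⁻¹ inside  opp = opp
    opposite⁻¹ outside opp = reflect-α-injective q (≈ᴹ-trans opp (≈ᴹ-sym (reflect-neg _ _)))

  LastFlip : ∀ {m} → Word m → Subset m → Fin m → Fin m → Set _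
  LastFlip Q I y x = Largest (SuffixNotGreedy Q I) y ×
    Largest (λ k → k ∈ I × rootFunction 𝒜 Q I k ≈ᴹ (-ᴹ rootFunction 𝒜 Q I y)) x

  raises⇒lastFlip : ∀ {m} (Q : Word m) {ρ I J i j} → Raises I i J j → IsFacet Q ρ I → IsFacet Q ρ J →
                    Positive (suffix i Q) (suffix i I) → LastFlip Q J i j
  raises⇒lastFlip Q {J = J} {i} r I-facet J-facet I-positive
    with (j∈J , rⱼ≈-rᵢ) , max ← raises⇒largestOpposite Q r I-facet J-facet I-positive =
    (raises⇒suffixNotGreedy Q r I-facet J-facet ,
     λ k k-notGreedy → ℕₚ.≮⇒≥ λ i<k → k-notGreedy
       (Positive⇒greedy (suffix k Q) (suffix-facet Q J k J-facet)
         (raises⇒Positive-suffix Q r I-facet J-facet I-positive k i<k))) ,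
    (j∈J , ≈ᴹ-trans (rootFunction≈root Q J _)
             (≈ᴹ-trans rⱼ≈-rᵢ (-ᴹ‿cong (≈ᴹ-sym (rootFunction≈root Q J i))))) ,
    λ k (k∈J , opp) → max k (k∈J , ≈ᴹ-trans (≈ᴹ-sym (rootFunction≈root Q J k))
                                     (≈ᴹ-trans opp (-ᴹ‿cong (rootFunction≈root Q J i))))

  -- The bound l is one more than the label that leads to P (0 at the start of a path).
  rising⇒lastFlip : ∀ {m} (Q : Word m) {ρ P F I} (π : Path Q ρ P F) (e : IncreasingFlip Q ρ F I) l →
                    (∀ k → l ℕ.≤ Fin.toℕ k → Positive (suffix k Q) (suffix k P)) →
                    All (λ k → l ℕ.≤ Fin.toℕ k) (pLabels (π ◅◅ (e ◅ nil))) →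
                    AllPairs Fin._<_ (pLabels (π ◅◅ (e ◅ nil))) →
                    LastFlip Q I (IncreasingFlip.out e) (IncreasingFlip.into e)
  rising⇒lastFlip Q nil e l P-positive (l≤out All.∷ _) _ =
    raises⇒lastFlip Q (flip⇒raises e) (IncreasingFlip.facetˡ e) (IncreasingFlip.facetʳ e)
      (P-positive (IncreasingFlip.out e) l≤out)
  rising⇒lastFlip Q (e′ ◅ π) e l P-positive (l≤out All.∷ _) (out<labels AllPairs.∷ labels-rising) =
    rising⇒lastFlip Q π e (ℕ.suc (Fin.toℕ (IncreasingFlip.out e′)))
      (raises⇒Positive-suffix Q (flip⇒raises e′) (IncreasingFlip.facetˡ e′) (IncreasingFlip.facetʳ e′)
        (P-positive (IncreasingFlip.out e′) l≤out))
      -- This is already the bound by the successor of the label, since `i Fin.< k` unfolds to an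
      -- inequality from the successor of i.
      out<labels labels-rising

  father⇒lastFlip : ∀ {m} (Q : Word m) {ρ P F I} → IsFacet Q ρ P → Positive Q P →
                    ((_ , e , _) : IsFather Q ρ P I F) →
                    LastFlip Q I (IncreasingFlip.out e) (IncreasingFlip.into e)
  father⇒lastFlip Q {P = P} P-facet P-positive (π , e , rising) =
    rising⇒lastFlip Q π e 0 (λ k _ → Positive-suffix Q P k P-facet P-positive)
      (All.universal (λ _ → ℕ.z≤n) _) (Linkedₚ.Linked⇒AllPairs Finₚ.<-trans rising)

proposition4p20 : ∀ {w ℓw c ℓ₁ ℓ₂ v ℓv : Level}
    (𝒲 : FiniteCoxeterSystem w ℓw)
    (K : OrderedField c ℓ₁ ℓ₂) (V : EuclideanSpace K v ℓv)
    (𝒜 : ReflectionAction 𝒲 V) →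
    let open FiniteCoxeterSystem 𝒲 using (Carrier)
        open SubwordComplex 𝒲
        open EuclideanSpace V
    in
    {m : ℕ} (Q : Word m) (ρ : Carrier) (P I : Subset m) →
    IsPositiveGreedy Q ρ P →
    IsFacet Q ρ I →
    I ≢ P →
    ∃[ y ] Largest (SuffixNotGreedy Q I) y ×
    (∃[ x ] Largest (λ k → k ∈ I × rootFunction 𝒜 Q I k ≈ᴹ (-ᴹ rootFunction 𝒜 Q I y)) x ×
    (∃[ F ] IsFather Q ρ P I F) ×
    (∀ F → IsFather Q ρ P I F → ObtainedByFlipping Q ρ I x F))
proposition4p20 𝒲 K V 𝒜 Q ρ P I (_ , P-unique) I-facet I≢P
  with SubwordComplexProperties.greedyPath 𝒜 Q I I-facet
... | P′ , P′-facet , P′-positive , π , rising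
  -- The path starts at its own positive facet, which is a source and hence the given P.
  with ≡.refl ← P-unique P′ (SubwordComplexProperties.Positive⇒source 𝒜 Q P′-facet P′-positive)
  with SubwordComplexProperties.snocView 𝒜 π
... | SubwordComplexProperties.[] = contradiction ≡.refl I≢P
-- The last edge supplies both positions: y is the one it flips out, x the one it flips in.
... | SubwordComplexProperties._∷ʳ_ {F} π′ e =
  IncreasingFlip.out e , y-largest , IncreasingFlip.into e , x-largest , (F , π′ , e , rising) , flips
  where
  open EuclideanSpace V
  open SubwordComplex 𝒲
  open SubwordComplexProperties 𝒜
  e-last : LastFlip Q I (IncreasingFlip.out e) (IncreasingFlip.into e)
  e-last = father⇒lastFlip Q P′-facet P′-positive (π′ , e , rising)
  y-largest = proj₁ e-last
  x-largest = proj₂ e-last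
  flips : ∀ F → IsFather Q ρ P I F → ObtainedByFlipping Q ρ I (IncreasingFlip.into e) F
  flips F father@(_ , f , _) =
    I-facet , IncreasingFlip.facetˡ f , IncreasingFlip.out f ,
    -- Going from I back to F removes the position flipped in, which by maximality is the same for
    -- every father.
    exchange-sym (≡.subst (Exchange F (IncreasingFlip.out f) I) x-unique (IncreasingFlip.exchange f))
    where
    f-last : LastFlip Q I (IncreasingFlip.out f) (IncreasingFlip.into f)
    f-last = father⇒lastFlip Q P′-facet P′-positive father
    y-unique : IncreasingFlip.out f ≡ IncreasingFlip.out e
    y-unique = Largest-unique (proj₁ f-last) y-largest
    x-unique : IncreasingFlip.into f ≡ IncreasingFlip.into e
    x-unique = Largest-unique
      (≡.subst
        (λ y → Largest (λ k → k ∈ I × rootFunction 𝒜 Q I k ≈ᴹ (-ᴹ rootFunction 𝒜 Q I y))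
                       (IncreasingFlip.into f))
        y-unique (proj₂ f-last)) x-largest
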